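{- Let $G$ be a graph polyhedrally embedded in a closed surface. Then for any three distinct vertices $x_1,x_2,x_3$ of $G$ and any other vertex $z\in V(G)\setminus\{x_1,x_2,x_3\}$, $G$ has a cycle that contains $x_1,x_2,x_3$ and avoids $z$.
   Context: Graphs are finite and simple. A closed surface is a compact connected 2-manifold without boundary. An embedding of a graph in a closed surface is polyhedral if every face is an open disk whose boundary is a cycle of the graph, and the boundaries of every two distinct faces meet properly, i.e., their intersection is either empty, or a single vertex, or a single edge (with its two endvertices). -}

module Defs where

open import Level using (0ℓ)
open import Data.Nat using (ℕ; suc; _≤_; NonZero)
open import Data.Nat.DivMod using (_mod_)
open import Data.Fin using (Fin; toℕ)
open import Data.Product using (Σ-syntax; ∃; ∃₂; _×_; _,_)
open import Data.Sum using (_⊎_)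
open import Function.Bundles using (_⇔_)
open import Function.Definitions using (Injective)
open import Relation.Binary.Core using (Rel)
open import Relation.Binary.Definitions using (Symmetric; Irreflexive; Decidable)
open import Relation.Binary.Construct.Closure.ReflexiveTransitive using (Star)
open import Relation.Binary.PropositionalEquality using (_≡_; _≢_)
open import Relation.Nullary using (¬_)

record Graph : Set₁ where
  field
    order    : ℕ
    _~_      : Rel (Fin order) 0ℓ
    ~-sym    : Symmetric _~_
    ~-irrefl : Irreflexive _≡_ _~_
    _~?_     : Decidable _~_

  V : Set
  V = Fin order

  Connected : Set
  Connected = ∀ u v → Star _~_ u v

next : ∀ {n} .{{_ : NonZero n}} → Fin n → Fin n
next {n} i = suc (toℕ i) mod n

module _ (G : Graph) where
  open Graph G

  record ClosedWalk : Set where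
    field
      length : ℕ
      {{length-nonZero}} : NonZero length
      vertex : Fin length → V
      step   : ∀ i → vertex i ~ vertex (next i)

    after : Fin length → Fin length
    after = next

module _ {G : Graph} where
  open Graph G
  open ClosedWalk

  Traverses : (W : ClosedWalk G) → Fin (length W) → V → V → Set
  Traverses W i u v = (vertex W i ≡ u × vertex W (after W i) ≡ v)
                   ⊎ (vertex W i ≡ v × vertex W (after W i) ≡ u)

  _∈ᵛ_ : V → ClosedWalk G → Set
  v ∈ᵛ W = ∃ λ i → vertex W i ≡ v

  _∉ᵛ_ : V → ClosedWalk G → Set
  v ∉ᵛ W = ¬ (v ∈ᵛ W)

  HasEdge : ClosedWalk G → V → V → Set
  HasEdge W u v = ∃ λ i → Traverses W i u v

  IsCycle : ClosedWalk G → Set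
  IsCycle W = 3 ≤ length W × Injective _≡_ _≡_ (vertex W)

  -- The common part of the two subgraphs is empty, a vertex, or an edge with
  -- its ends.  Edges need no separate bound: G is simple, so every common edge
  -- is determined by its two distinct common ends.
  MeetProperly : ClosedWalk G → ClosedWalk G → Set
  MeetProperly W W′ =
      (∀ w → ¬ Common w)
    ⊎ (∃ λ v → ∀ w → Common w ⇔ (w ≡ v))
    ⊎ (∃₂ λ u v → HasEdge W u v × HasEdge W′ u v
                × (∀ w → Common w ⇔ (w ≡ u ⊎ w ≡ v)))
    where
    Common : V → Set
    Common w = w ∈ᵛ W × w ∈ᵛ W′

record Polygons (G : Graph) : Set where
  open Graph G
  open ClosedWalk

  field
    faceCount : ℕ
    {{faceCount-nonZero}} : NonZero faceCount
    face      : Fin faceCount → ClosedWalk G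

  -- (f , i) is the i-th corner of face f, and also the side from that corner to
  -- the next one.
  Corner : Set
  Corner = Σ[ f ∈ Fin faceCount ] Fin (length (face f))

  Side : Set
  Side = Corner

  LiesOn : Side → V → V → Set
  LiesOn (f , i) = Traverses (face f) i

  apex : Corner → V
  apex (f , i) = vertex (face f) i

  -- One of the two sides of the face meeting in the corner leads to w.
  LeadsTo : Corner → V → Set
  LeadsTo (f , i) w = vertex (face f) (after (face f) i) ≡ w
                    ⊎ (∃ λ j → after (face f) j ≡ i × vertex (face f) j ≡ w)

  Linked : Rel Corner 0ℓ
  Linked c d = apex c ≡ apex d × (∃ λ w → LeadsTo c w × LeadsTo d w)

-- An embedding of G in a closed surface with every face an open disk, given
-- combinatorially and up to homeomorphism, for G with at least one edge.  Each
-- face is a polygon whose boundary is attached to G along a closed walk; the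
-- surface is the resulting 2-complex.  It may be orientable or not.
--   * The complex is connected since G is.
--   * two-sides: exactly two polygon sides are attached to each edge, so the
--     complex is a surface at interior points of edges.
--   * umbrella: the corners at a vertex, two of them being linked when they
--     have a side on a common edge at that vertex, are connected.  By two-sides
--     they then form one cyclic sequence, i.e. the vertex has a disk
--     neighbourhood.
-- Conversely every embedding with open disks as faces arises in this way, from
-- its facial walks.
record CellularEmbedding (G : Graph) : Set where
  open Graph G

  field
    connected : Connected
    polygons  : Polygons G

  open Polygons polygons public

  field
    two-sides : ∀ {u v} → u ~ v →
                ∃₂ λ s t → s ≢ t × LiesOn s u v × LiesOn t u v
                         × (∀ r → LiesOn r u v → r ≡ s ⊎ r ≡ t)
    umbrella  : ∀ c d → apex c ≡ apex d → Star Linked c d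

record IsPolyhedral {G : Graph} (E : CellularEmbedding G) : Set where
  open CellularEmbedding E

  field
    boundary-cycle : ∀ f → IsCycle (face f)
    meet-properly  : ∀ {f g} → f ≢ g → MeetProperly (face f) (face g)

{-# OPTIONS --safe #-}

-- The faces around a vertex v fit together to a wheel, whose rim is a cycle of
-- G - v through all neighbours of v.  Hence G has no vertex cut of size two, and
-- with K the rim at z, no two vertices of H = G - z separate a vertex from K.
--
-- Put as many of the three vertices x as possible on a cycle K of H from which no
-- two vertices separate any of them.  If two of them are on K, Menger's theorem
-- gives three paths from the third to K, which divide K into three arcs; replacing
-- an arc without the first two vertices by two of the paths gives the cycle.  If at
-- most one is on K, reroute K in this way through another one to a cycle C.  Either
-- C can be rerouted through a further x, or two vertices s and t cut a set D
-- containing that x off from C.  In the latter case K runs through both s and t,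
-- and rerouting it through a vertex x within D, or else on the far side of s and
-- t, improves K.
module Submission where

open import Defs
open import Data.Empty using (⊥; ⊥-elim)
open import Data.Fin using (Fin; zero; suc; punchOut; toℕ; fromℕ; inject₁)
import Data.Fin.Properties as Fin
open import Data.Fin.Relation.Unary.Top using (view; ‵fromℕ; ‵inject₁)
open import Data.Fin.Subset using (Subset; ⁅_⁆; _∪_) renaming (_∈_ to _∈ˢ_; _∉_ to _∉ˢ_; _⊃_ to _⊋_)
open import Data.Fin.Subset.Induction using (⊃-wellFounded)
import Data.Fin.Subset.Properties as Sub
open import Data.List using (List; []; _∷_; _++_; length; lookup; reverse; cartesianProduct; allFin; filter)
import Data.List.Membership.DecPropositional as DecMembership
open import Data.List.Membership.Propositional using (_∈_; _∉_)
open import Data.List.Membership.Propositional.Properties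
import Data.List.Properties as List
open import Data.List.Relation.Binary.Disjoint.Propositional using (Disjoint)
open import Data.List.Relation.Binary.Permutation.Propositional
  using (_↭_; ↭-sym; ↭-trans; ↭-refl; ↭-reflexive; prep; ↭⇒↭ₛ; module PermutationReasoning)
open import Data.List.Relation.Binary.Permutation.Propositional.Properties
  using (∈-resp-↭; ↭-length; ++-comm; ↭-reverse; shift; ++⁺ˡ; ++⁺ʳ)
import Data.List.Relation.Binary.Permutation.Setoid.Properties as Permutationₛ
open import Data.List.Relation.Unary.All as All using (All; []; _∷_)
import Data.List.Relation.Unary.All.Properties as All
open import Data.List.Relation.Unary.AllPairs using ([]; _∷_)
open import Data.List.Relation.Unary.Any using (here; there; index)
import Data.List.Relation.Unary.Any.Properties as Any
open import Data.List.Relation.Unary.Unique.Propositional using (Unique)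
import Data.List.Relation.Unary.Unique.Propositional.Properties as Unique
open import Data.Nat using (ℕ; zero; suc; _+_; _*_; _≤_; _<_; z≤n; s≤s; NonZero; _%_; _/_; _≤?_)
open import Data.Nat.DivMod
  using (_mod_; m≡m%n+[m/n]*n; m%n<n; m<n⇒m%n≡m; [m+n]%n≡m%n; %-distribˡ-+; m%n%n≡m%n; n%n≡0)
import Data.Nat.Properties as ℕ
open import Data.Product using (Σ-syntax; ∃; ∃₂; _×_; _,_; proj₁; proj₂)
open import Data.Sum as Sum using (_⊎_; inj₁; inj₂)
open import Function using (_∘_)
open import Function.Bundles using (Equivalence)
open import Function.Definitions using (Injective)
open import Induction.WellFounded using (Acc; acc)
open import Level using (0ℓ)
open import Relation.Binary.Construct.Closure.ReflexiveTransitive using (Star; ε; _◅_)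
open import Relation.Binary.Core using (Rel)
import Relation.Binary.Definitions as B
open import Relation.Binary.PropositionalEquality as Eq using (_≡_; _≢_; refl; sym; trans; cong; subst; setoid)
open import Relation.Nullary using (¬_; Dec; yes; no)
open import Relation.Nullary.Decidable using (_×-dec_; _⊎-dec_; ¬?)
open import Relation.Unary using (Pred; Decidable)

-- The obstacle is that `G - z` may well have cuts of two vertices, and absence of cut vertices
-- alone does not put three vertices on a cycle: the complete bipartite graph with classes of sizes
-- 2 and 3 has no cycle through the larger class. What helps is that a nonempty set cut off by two
-- vertices in `G - z` and missing the rim at `z` contains no neighbour of `z`, so it would be cut
-- off in `G` as well. Thus each such set contains vertices of the rim. `NonSep` records this for
-- one vertex and one cycle. The rim itself is soon lost, because the cycle is rerouted; `NonSep` is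
-- not, as long as the rerouting is confined to one side of a cut whose two vertices stay on the
-- cycle, and the vertex in question is not on that side. Hence the care about the side on which a
-- vertex is absorbed. Walks, separators and cuts are given by decidable vertex sets, so that every
-- case distinction is effective.

-- Menger's theorem

injective⇒surjective : ∀ {n} (f : Fin n → Fin n) → Injective _≡_ _≡_ f → ∀ j → ∃ λ i → f i ≡ j
injective⇒surjective {suc n} f inj j with Fin.any? (λ i → f i Fin.≟ j)
... | yes p = p
... | no ¬p = ⊥-elim (ℕ.1+n≰n (Fin.injective⇒≤ {f = λ i → punchOut (j≢f i)}
                (λ {i} {k} eq → inj (Fin.punchOut-injective (j≢f i) (j≢f k) eq))))
  where
  j≢f : ∀ i → j ≢ f i
  j≢f i j≡fi = ¬p (i , sym j≡fi)

module _ {V : Set} where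

  data Walk (R : Rel V 0ℓ) (Q : Pred V 0ℓ) : V → V → Set where
    stop : ∀ {a} → Q a → Walk R Q a a
    step : ∀ {a b c} → Q a → R a b → Walk R Q b c → Walk R Q a c

  mapʷ : ∀ {R R′ : Rel V 0ℓ} {Q Q′ : Pred V 0ℓ} →
         (∀ {u v} → R u v → R′ u v) → (∀ {v} → Q v → Q′ v) →
         ∀ {a b} → Walk R Q a b → Walk R′ Q′ a b
  mapʷ r q (stop x)     = stop (q x)
  mapʷ r q (step x e w) = step (q x) (r e) (mapʷ r q w)

  _++ʷ_ : ∀ {R : Rel V 0ℓ} {Q : Pred V 0ℓ} {a b c} → Walk R Q a b → Walk R Q b c → Walk R Q a c
  stop _     ++ʷ w′ = w′
  step q e w ++ʷ w′ = step q e (w ++ʷ w′)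

  _++⟨_⟩_ : ∀ {R : Rel V 0ℓ} {Q : Pred V 0ℓ} {a b c d} →
            Walk R Q a b → R b c → Walk R Q c d → Walk R Q a d
  stop q     ++⟨ e ⟩ w′ = step q e w′
  step q f w ++⟨ e ⟩ w′ = step q f (w ++⟨ e ⟩ w′)

  headʷ : ∀ {R : Rel V 0ℓ} {Q : Pred V 0ℓ} {a b} → Walk R Q a b → Q a
  headʷ (stop q)     = q
  headʷ (step q _ _) = q

  lastʷ : ∀ {R : Rel V 0ℓ} {Q : Pred V 0ℓ} {a b} → Walk R Q a b → Q b
  lastʷ (stop q)     = q
  lastʷ (step _ _ w) = lastʷ w

  Image : ∀ {k} → (Fin k → V) → Pred V 0ℓ
  Image S v = ∃ λ i → S i ≡ v

  Arc : List (V × V) → Rel V 0ℓ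
  Arc E u v = (u , v) ∈ E

  -- `on i` holds at all vertices of the i-th walk and may hold elsewhere. Disjointness is asked of
  -- these predicates, so the walks may repeat vertices and are not shortened during the induction.
  record Linkage (k : ℕ) (R : Rel V 0ℓ) (A B : Pred V 0ℓ) : Set₁ where
    field
      on       : Fin k → Pred V 0ℓ
      src tgt  : Fin k → V
      src∈     : ∀ i → A (src i)
      tgt∈     : ∀ i → B (tgt i)
      walk     : ∀ i → Walk R (on i) (src i) (tgt i)
      disjoint : ∀ {i j v} → i ≢ j → on i v → on j v → ⊥

  -- X is the part of the graph that stays reachable from A once S is deleted.
  record Separator (k : ℕ) (R : Rel V 0ℓ) (A B : Pred V 0ℓ) : Set₁ where
    field
      S      : Fin k → V
      X      : Pred V 0ℓ
      X?     : Decidable X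
      S∉X    : ∀ i → ¬ X (S i)
      start  : ∀ {v} → A v → X v ⊎ Image S v
      closed : ∀ {u v} → X u → R u v → X v ⊎ Image S v
      finish : ∀ {v} → X v → ¬ B v

  cons : ∀ {k} → V → (Fin k → V) → Fin (suc k) → V
  cons x S zero    = x
  cons x S (suc i) = S i

  -- The k distinct values of `e` are among the k values of `P`, so the map of indices `σ` is
  -- injective, hence bijective, and `τ` inverts it. This lets two linkages that meet in the same k
  -- vertices be glued index by index.
  relabel : ∀ {k} (P e : Fin k → V) → (∀ i → Image P (e i)) → (∀ {i j} → i ≢ j → e i ≢ e j) →
            ∃ λ (τ : Fin k → Fin k) → Injective _≡_ _≡_ τ × (∀ i → e (τ i) ≡ P i)
  relabel P e e∈ e≢ = τ , (λ eq → trans (sym (στ _)) (trans (cong σ eq) (στ _))) ,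
                      λ i → trans (sym (proj₂ (e∈ (τ i)))) (cong P (στ i))
    where
    σ = proj₁ ∘ e∈
    σ-injective : Injective _≡_ _≡_ σ
    σ-injective {i} {j} eq with i Fin.≟ j
    ... | yes i≡j = i≡j
    ... | no i≢j  = ⊥-elim (e≢ i≢j (trans (sym (proj₂ (e∈ i))) (trans (cong P eq) (proj₂ (e∈ j)))))
    τ = proj₁ ∘ injective⇒surjective σ σ-injective
    στ : ∀ j → σ (τ j) ≡ j
    στ = proj₂ ∘ injective⇒surjective σ σ-injective

  permute : ∀ {k R A B} → Linkage k R A B → (τ : Fin k → Fin k) → Injective _≡_ _≡_ τ → Linkage k R A B
  permute L τ τ-injective = record
    { on = on ∘ τ ; src = src ∘ τ ; tgt = tgt ∘ τ ; src∈ = src∈ ∘ τ ; tgt∈ = tgt∈ ∘ τ ; walk = walk ∘ τ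
    ; disjoint = λ i≢j → disjoint (i≢j ∘ τ-injective) }
    where open Linkage L

  toTargets : ∀ {k R A} (P : Fin k → V) → Linkage k R A (Image P) →
              Σ[ L ∈ Linkage k R A (Image P) ] (∀ i → Linkage.tgt L i ≡ P i)
  toTargets P L = permute L τ τ-injective , tgt≡
    where
    open Linkage L
    tgt≢ : ∀ {i j} → i ≢ j → tgt i ≢ tgt j
    tgt≢ {i} {j} i≢j eq = disjoint i≢j (lastʷ (walk i)) (subst (on j) (sym eq) (lastʷ (walk j)))
    relabelled = relabel P tgt tgt∈ tgt≢
    τ = proj₁ relabelled
    τ-injective = proj₁ (proj₂ relabelled)
    tgt≡ = proj₂ (proj₂ relabelled)

  fromSources : ∀ {k R B} (P : Fin k → V) → Linkage k R (Image P) B →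
                Σ[ L ∈ Linkage k R (Image P) B ] (∀ i → Linkage.src L i ≡ P i)
  fromSources P L = permute L τ τ-injective , src≡
    where
    open Linkage L
    src≢ : ∀ {i j} → i ≢ j → src i ≢ src j
    src≢ {i} {j} i≢j eq = disjoint i≢j (headʷ (walk i)) (subst (on j) (sym eq) (headʷ (walk j)))
    relabelled = relabel P src src∈ src≢
    τ = proj₁ relabelled
    τ-injective = proj₁ (proj₂ relabelled)
    src≡ = proj₂ (proj₂ relabelled)

  module _ {R : Rel V 0ℓ} {X P : Pred V 0ℓ} (P? : Decidable P) where

    -- An arc out of `X` ends in `P`, so up to its first vertex in `P` the walk is confined to `X`.
    untilFirst : ∀ {Q : Pred V 0ℓ} {a b} →
                 (∀ {u v} → X u → R u v → X v ⊎ P v) →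
                 Walk R Q a b → P b → X a ⊎ P a →
                 ∃ λ p → P p × Walk R (λ v → Q v × ((X v × ¬ P v) ⊎ v ≡ p)) a p
    untilFirst cl (stop q) Pb _ = _ , Pb , stop (q , inj₂ refl)
    untilFirst cl (step {a} q e w) Pb Xa with P? a
    ... | yes Pa = a , Pa , stop (q , inj₂ refl)
    ... | no ¬Pa with Xa
    ...   | inj₂ Pa = ⊥-elim (¬Pa Pa)
    ...   | inj₁ Xa with untilFirst cl w Pb (cl Xa e)
    ...     | p , Pp , w′ = p , Pp , step (q , inj₁ (Xa , ¬Pa)) e w′

    -- Read backwards from its end outside `X`, the walk cannot get into `X` before it meets `P`,
    -- because an arc that starts in `X` ends in `X` or `P`.
    fromLast : ∀ {Q : Pred V 0ℓ} {a b} →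
               (∀ {u v} → X u → R u v → X v ⊎ P v) →
               Walk R Q a b → ¬ X b →
               Walk R (λ v → Q v × (¬ X v × ¬ P v)) a b ⊎
               (∃ λ p → P p × Walk R (λ v → Q v × ((¬ X v × ¬ P v) ⊎ v ≡ p)) p b)
    fromLast cl (stop {a} q) ¬Xb with P? a
    ... | yes Pa = inj₂ (a , Pa , stop (q , inj₂ refl))
    ... | no ¬Pa = inj₁ (stop (q , ¬Xb , ¬Pa))
    fromLast cl (step {a} q e w) ¬Xb with fromLast cl w ¬Xb
    ... | inj₂ r = inj₂ r
    ... | inj₁ w′ with P? a
    ...   | yes Pa = inj₂ (a , Pa , step (q , inj₂ refl) e (mapʷ (λ x → x) (λ { (x , y) → x , inj₁ y }) w′))
    ...   | no ¬Pa = inj₁ (step (q , ¬Xa , ¬Pa) e w′)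
      where
      ¬Xa : ¬ X a
      ¬Xa Xa with cl Xa e
      ... | inj₁ Xc = proj₁ (proj₂ (headʷ w′)) Xc
      ... | inj₂ Pc = proj₂ (proj₂ (headʷ w′)) Pc

module _ {n : ℕ} where
  private
    V = Fin n

  image? : ∀ {k} (S : Fin k → V) → Decidable (Image S)
  image? S v = Fin.any? (λ i → S i Fin.≟ v)

  distinctOrCovered : V → ∀ k {P : Pred V 0ℓ} → Decidable P →
    (∃ λ (f : Fin (suc k) → V) → Injective _≡_ _≡_ f × (∀ i → P (f i))) ⊎
    (∃ λ (S : Fin k → V) → ∀ {v} → P v → Image S v)
  distinctOrCovered v₀ zero P? with Fin.any? P?
  ... | yes (v , Pv) = inj₁ ((λ _ → v) , (λ { {zero} {zero} _ → refl }) , λ _ → Pv)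
  ... | no ¬P        = inj₂ ((λ ()) , λ Pv → ⊥-elim (¬P (_ , Pv)))
  distinctOrCovered v₀ (suc k) P? with distinctOrCovered v₀ k P?
  -- `v₀` only pads the cover to the required number of entries.
  ... | inj₂ (S , cov) = inj₂ (cons v₀ S , λ Pv → let i , eq = cov Pv in suc i , eq)
  ... | inj₁ (f , inj , Pf) with Fin.any? (λ v → P? v ×-dec ¬? (image? f v))
  ...   | no none = inj₂ (f , λ {v} Pv → cov v Pv)
    where
    cov : ∀ v → _ → Image f v
    cov v Pv with image? f v
    ... | yes im = im
    ... | no ¬im = ⊥-elim (none (v , Pv , ¬im))
  ...   | yes (v , Pv , v∉f) = inj₁ (cons v f , inj′ , λ { zero → Pv ; (suc i) → Pf i })
    where
    inj′ : Injective _≡_ _≡_ (cons v f)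
    inj′ {zero}  {zero}  _  = refl
    inj′ {zero}  {suc j} eq = ⊥-elim (v∉f (j , sym eq))
    inj′ {suc i} {zero}  eq = ⊥-elim (v∉f (i , eq))
    inj′ {suc i} {suc j} eq = cong suc (inj eq)

  private
    module AddArc {k} (x y : V) (E : List (V × V)) {A B : Pred V 0ℓ}
                  (sep : Separator k (Arc E) A B) where
      open Separator sep
      E⁺ = (x , y) ∷ E
      P = cons x S
      Q = cons y S

      unchanged : ¬ X x ⊎ X y → Separator k (Arc E⁺) A B
      unchanged h = record
        { S = S ; X = X ; X? = X? ; S∉X = S∉X ; start = start ; finish = finish ; closed = closed⁺ h }
        where
        closed⁺ : ¬ X x ⊎ X y → ∀ {u v} → X u → Arc E⁺ u v → X v ⊎ Image S v
        closed⁺ _          Xu (there e)   = closed Xu e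
        closed⁺ (inj₁ ¬Xx) Xu (here refl) = ⊥-elim (¬Xx Xu)
        closed⁺ (inj₂ Xy)  Xu (here refl) = inj₁ Xy

      module _ (Xx : X x) (¬Xy : ¬ X y) where

        -- A walk from `A` to `B` leaves `X` through `S` or by the new arc, so it meets `P`. What
        -- blocks `A` from `P` therefore blocks `A` from `B`.
        left : Separator k (Arc E) A (Image P) → Separator k (Arc E⁺) A B
        left s′ = record
          { S = S′.S ; X = λ v → X v × S′.X v ; X? = λ v → X? v ×-dec S′.X? v
          ; S∉X = λ i → S′.S∉X i ∘ proj₂
          ; start = λ Av → meet (start Av) (S′.start Av)
          ; closed = λ { (_ , X′u) (here refl) → ⊥-elim (S′.finish X′u (zero , refl))
                       ; (Xu , X′u) (there e) → meet (closed Xu e) (S′.closed X′u e) }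
          ; finish = finish ∘ proj₁ }
          where
          module S′ = Separator s′
          meet : ∀ {v} → X v ⊎ Image S v → S′.X v ⊎ Image S′.S v → (X v × S′.X v) ⊎ Image S′.S v
          meet _               (inj₂ s)   = inj₂ s
          meet (inj₁ Xv)       (inj₁ X′v) = inj₁ (Xv , X′v)
          meet (inj₂ (i , eq)) (inj₁ X′v) = ⊥-elim (S′.finish X′v (suc i , eq))

        -- Dually, a walk from `A` to `B` meets `Q`, and after its last vertex there it uses old
        -- arcs only, since the new arc ends in `Q`; so `S′.S` blocks it. The image of `S′.S` is
        -- taken out of the union because it may meet `X`.
        right : Separator k (Arc E) (Image Q) B → Separator k (Arc E⁺) A B
        right s′ = record
          { S = S′.S ; X = λ v → (X v ⊎ S′.X v) × ¬ Image S′.S v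
          ; X? = λ v → (X? v ⊎-dec S′.X? v) ×-dec ¬? (image? S′.S v)
          ; S∉X = λ i h → proj₂ h (i , refl)
          ; start = λ Av → join (inj₁ (start Av))
          ; closed = λ { _ (here refl) → join (inj₂ (S′.start (zero , refl)))
                       ; (inj₁ Xu , _) (there e) → join (inj₁ (closed Xu e))
                       ; (inj₂ X′u , _) (there e) → join (inj₂ (S′.closed X′u e)) }
          ; finish = λ { (inj₁ Xv , _) → finish Xv ; (inj₂ X′v , _) → S′.finish X′v } }
          where
          module S′ = Separator s′
          join : ∀ {v} → (X v ⊎ Image S v) ⊎ (S′.X v ⊎ Image S′.S v) →
                 ((X v ⊎ S′.X v) × ¬ Image S′.S v) ⊎ Image S′.S v
          join {v} h with image? S′.S v
          ... | yes s = inj₂ s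
          ... | no ¬s with h
          ...   | inj₁ (inj₁ Xv) = inj₁ (inj₁ Xv , ¬s)
          ...   | inj₂ (inj₁ Xv) = inj₁ (inj₂ Xv , ¬s)
          ...   | inj₂ (inj₂ s)  = ⊥-elim (¬s s)
          ...   | inj₁ (inj₂ (i , eq)) with S′.start (suc i , eq)
          ...     | inj₁ X′v = inj₁ (inj₂ X′v , ¬s)
          ...     | inj₂ s   = ⊥-elim (¬s s)

        -- Cut at their first vertex in `P`, the walks of `l₁` stay in `X` until there; cut at their
        -- last vertex in `Q`, those of `l₂` stay outside `X` from there. So they can meet only in
        -- `S`, where equal indices fit together, and the new arc joins the two walks of index zero.
        linked : Linkage (suc k) (Arc E) A (Image P) → Linkage (suc k) (Arc E) (Image Q) B →
                 Linkage (suc k) (Arc E⁺) A B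
        linked l₁ l₂ = record
          { on = λ i v → on₁ i v ⊎ on₂ i v ; src = L₁.src ; tgt = L₂.tgt
          ; src∈ = L₁.src∈ ; tgt∈ = L₂.tgt∈
          ; walk = λ i → glue i (mapʷ there inj₁ (walk₁ i)) (mapʷ there inj₂ (walk₂ i))
          ; disjoint = λ { i≢j (inj₁ p) (inj₁ q) → L₁.disjoint i≢j (proj₁ p) (proj₁ q)
                         ; i≢j (inj₂ p) (inj₂ q) → L₂.disjoint i≢j (proj₁ p) (proj₁ q)
                         ; i≢j (inj₁ p) (inj₂ q) → cross i≢j p q
                         ; i≢j (inj₂ p) (inj₁ q) → cross (i≢j ∘ sym) q p } }
          where
          P? = image? P
          Q? = image? Q
          module L₁ = Linkage (proj₁ (toTargets P l₁))
          module L₂ = Linkage (proj₁ (fromSources Q l₂))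
          tgt₁ = proj₂ (toTargets P l₁)
          src₂ = proj₂ (fromSources Q l₂)

          widen : ∀ {z v} → X v ⊎ Image S v → X v ⊎ Image (cons z S) v
          widen (inj₁ Xv)       = inj₁ Xv
          widen (inj₂ (i , eq)) = inj₂ (suc i , eq)

          on₁ on₂ : Fin (suc k) → Pred V 0ℓ
          on₁ i v = L₁.on i v × ((X v × ¬ Image P v) ⊎ v ≡ P i)
          on₂ i v = L₂.on i v × ((¬ X v × ¬ Image Q v) ⊎ v ≡ Q i)

          walk₁ : ∀ i → Walk (Arc E) (on₁ i) (L₁.src i) (P i)
          walk₁ i with untilFirst P? (λ Xu e → widen (closed Xu e)) (L₁.walk i) (L₁.tgt∈ i)
                         (widen (start (L₁.src∈ i)))
          ... | p , (j , refl) , w with i Fin.≟ j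
          ...   | yes refl = w
          ...   | no i≢j = ⊥-elim (L₁.disjoint i≢j (proj₁ (lastʷ w))
                             (subst (L₁.on j) (tgt₁ j) (lastʷ (L₁.walk j))))

          walk₂ : ∀ i → Walk (Arc E) (on₂ i) (Q i) (L₂.tgt i)
          walk₂ i with fromLast Q? (λ Xu e → widen (closed Xu e)) (L₂.walk i)
                         (λ Xb → finish Xb (L₂.tgt∈ i))
          ... | inj₁ w = ⊥-elim (proj₂ (proj₂ (headʷ w)) (i , sym (src₂ i)))
          ... | inj₂ (p , (j , refl) , w) with i Fin.≟ j
          ...   | yes refl = w
          ...   | no i≢j = ⊥-elim (L₂.disjoint i≢j (proj₁ (headʷ w))
                             (subst (L₂.on j) (src₂ j) (headʷ (L₂.walk j))))

          glue : ∀ i {O : Pred V 0ℓ} {a b} → Walk (Arc E⁺) O a (P i) → Walk (Arc E⁺) O (Q i) b →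
                 Walk (Arc E⁺) O a b
          glue zero    w w′ = w ++⟨ here refl ⟩ w′
          glue (suc i) w w′ = w ++ʷ w′

          Q∉X : ∀ j → ¬ X (Q j)
          Q∉X zero    = ¬Xy
          Q∉X (suc j) = S∉X j

          cross : ∀ {i j v} → i ≢ j → on₁ i v → on₂ j v → ⊥
          cross i≢j (_ , inj₁ (Xv , _)) (_ , inj₁ (¬Xv , _)) = ¬Xv Xv
          cross {j = j} i≢j (_ , inj₁ (Xv , _)) (_ , inj₂ refl) = Q∉X j Xv
          cross {zero} i≢j (_ , inj₂ refl) (_ , inj₁ (¬Xv , _)) = ¬Xv Xx
          cross {suc i} i≢j (_ , inj₂ refl) (_ , inj₁ (_ , ¬Qv)) = ¬Qv (suc i , refl)
          -- If `y` were in `S`, two walks of `L₂` would start in it.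
          cross {i} {zero} i≢j (_ , inj₂ eq) (_ , inj₂ refl) = atY i i≢j eq
            where
            atY : ∀ i → i ≢ zero → Q zero ≡ P i → ⊥
            atY zero    i≢0 _  = i≢0 refl
            atY (suc i) i≢0 eq = L₂.disjoint i≢0 (proj₁ (headʷ (walk₂ (suc i))))
                                   (subst (L₂.on zero) eq (proj₁ (headʷ (walk₂ zero))))
          cross {i} {suc j} i≢j (h , inj₂ refl) (_ , inj₂ eq) =
            L₁.disjoint i≢j h (subst (L₁.on (suc j)) (sym eq) (proj₁ (lastʷ (walk₁ (suc j)))))

  -- Göring's proof: with x → y the new arc and S separating A from B without it,
  -- either S still separates, or the induction hypothesis is applied to the pairs
  -- (A , {x} ∪ S) and ({y} ∪ S , B).
  menger : V → ∀ k (E : List (V × V)) {A B : Pred V 0ℓ} → Decidable A → Decidable B →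
           Linkage (suc k) (Arc E) A B ⊎ Separator k (Arc E) A B
  menger v₀ k [] {A} {B} A? B? with distinctOrCovered v₀ k (λ v → A? v ×-dec B? v)
  ... | inj₁ (f , inj , ABf) = inj₁ record
    { on = λ i v → f i ≡ v ; src = f ; tgt = f ; src∈ = proj₁ ∘ ABf ; tgt∈ = proj₂ ∘ ABf
    ; walk = λ i → stop refl ; disjoint = λ i≢j p q → i≢j (inj (trans p (sym q))) }
  ... | inj₂ (S , cov) = inj₂ record
    { S = S ; X = λ v → A v × ¬ Image S v ; X? = λ v → A? v ×-dec ¬? (image? S v)
    ; S∉X = λ i h → proj₂ h (i , refl)
    ; start = λ {v} → start v
    ; closed = λ _ ()
    ; finish = λ { (Av , ¬s) Bv → ¬s (cov (Av , Bv)) } }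
    where
    start : ∀ v → A v → (A v × ¬ Image S v) ⊎ Image S v
    start v Av with image? S v
    ... | yes s = inj₂ s
    ... | no ¬s = inj₁ (Av , ¬s)
  menger v₀ k ((x , y) ∷ E) {A} {B} A? B? with menger v₀ k E A? B?
  ... | inj₁ l = inj₁ record
    { on = on ; src = src ; tgt = tgt ; src∈ = src∈ ; tgt∈ = tgt∈
    ; walk = λ i → mapʷ there (λ q → q) (walk i) ; disjoint = disjoint }
    where open Linkage l
  ... | inj₂ sep with Separator.X? sep x | Separator.X? sep y
  ...   | no ¬Xx | _      = inj₂ (AddArc.unchanged x y E sep (inj₁ ¬Xx))
  ...   | yes _  | yes Xy = inj₂ (AddArc.unchanged x y E sep (inj₂ Xy))
  ...   | yes Xx | no ¬Xy
    with menger v₀ k E A? (image? (AddArc.P x y E sep)) | menger v₀ k E (image? (AddArc.Q x y E sep)) B?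
  ...     | inj₂ s′ | _       = inj₂ (AddArc.left x y E sep Xx ¬Xy s′)
  ...     | inj₁ _  | inj₂ s′ = inj₂ (AddArc.right x y E sep Xx ¬Xy s′)
  ...     | inj₁ l₁ | inj₁ l₂ = inj₁ (AddArc.linked x y E sep Xx ¬Xy l₁ l₂)

-- Paths, cycles and fans

module _ {V : Set} where

  Unique-resp-↭ : {xs ys : List V} → xs ↭ ys → Unique xs → Unique ys
  Unique-resp-↭ p = Permutationₛ.Unique-resp-↭ (setoid V) (↭⇒↭ₛ p)

  Unique-++⁻ : ∀ xs {ys : List V} → Unique (xs ++ ys) → Unique xs × Unique ys × Disjoint xs ys
  Unique-++⁻ []       u = [] , u , λ ()
  Unique-++⁻ (x ∷ xs) (x∉ ∷ u) with Unique-++⁻ xs u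
  ... | ux , uy , d = (All.++⁻ˡ xs x∉ ∷ ux) , uy ,
    λ { (here refl , v∈ys) → All.lookup (All.++⁻ʳ xs x∉) v∈ys refl
      ; (there v∈xs , v∈ys) → d (v∈xs , v∈ys) }

  Unique-∷⁻ : ∀ {x} {xs : List V} → Unique (x ∷ xs) → x ∉ xs
  Unique-∷⁻ (x∉ ∷ _) x∈ = All.lookup x∉ x∈ refl

  Unique-∷⁺ : ∀ {x} {xs : List V} → x ∉ xs → Unique xs → Unique (x ∷ xs)
  Unique-∷⁺ x∉ u = All.tabulate (λ { v∈ refl → x∉ v∈ }) ∷ u

  -- The list holds the inner vertices only, so that Seg R c l c is a closed walk
  -- whose vertices, each listed once, are c ∷ l.
  data Seg (R : Rel V 0ℓ) : V → List V → V → Set where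
    edge : ∀ {a b} → R a b → Seg R a [] b
    step : ∀ {a c l b} → R a c → Seg R c l b → Seg R a (c ∷ l) b

  module _ {R : Rel V 0ℓ} where

    _++ˢ_ : ∀ {a l b m c} → Seg R a l b → Seg R b m c → Seg R a (l ++ b ∷ m) c
    edge e   ++ˢ s′ = step e s′
    step e s ++ˢ s′ = step e (s ++ˢ s′)

    splitˢ : ∀ {a b c m} l → Seg R a (l ++ b ∷ m) c → Seg R a l b × Seg R b m c
    splitˢ []      (step e s) = edge e , s
    splitˢ (_ ∷ l) (step e s) = let s₁ , s₂ = splitˢ l s in step e s₁ , s₂

    reverseˢ : B.Symmetric R → ∀ {a l b} → Seg R a l b → Seg R b (reverse l) a
    reverseˢ sy (edge e) = edge (sy e)
    reverseˢ sy {a} {c ∷ l} {b} (step e s) =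
      subst (λ m → Seg R b m a) (sym (List.unfold-reverse c l)) (reverseˢ sy s ++ˢ edge (sy e))

    stay : ∀ {D O : Pred V 0ℓ} → (∀ {u v} → D u → R u v → D v ⊎ O v) →
           ∀ {a l b} → Seg R a l b → D a → (∀ {v} → v ∈ l → ¬ O v) →
           (∀ {v} → v ∈ l → D v) × (D b ⊎ O b)
    stay cl (edge e) Da _ = (λ ()) , cl Da e
    stay cl (step e s) Da ¬O with cl Da e
    ... | inj₂ Oc = ⊥-elim (¬O (here refl) Oc)
    ... | inj₁ Dc = let h , end = stay cl s Dc (¬O ∘ there)
                    in (λ { (here refl) → Dc ; (there v∈) → h v∈ }) , end

  record IsCyc (R : Rel V 0ℓ) (c : V) (l : List V) : Set where
    constructor mkCyc
    field
      closed : Seg R c l c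
      unique : Unique (c ∷ l)
      long   : 2 ≤ length l

  record Cyc (R : Rel V 0ℓ) : Set where
    constructor cyc
    field
      {base} : V
      {rest} : List V
      isCyc  : IsCyc R base rest
    verts : List V
    verts = base ∷ rest

  open Cyc using (verts) public

  module _ {R : Rel V 0ℓ} where

    rotateAt : ∀ {c d m} l → IsCyc R c (l ++ d ∷ m) →
               IsCyc R d (m ++ c ∷ l) × c ∷ l ++ d ∷ m ↭ d ∷ m ++ c ∷ l
    rotateAt {c} {d} {m} l (mkCyc cl un lo) =
      mkCyc (proj₂ (splitˢ l cl) ++ˢ proj₁ (splitˢ l cl)) (Unique-resp-↭ p un)
        (subst (2 ≤_) (ℕ.suc-injective (↭-length p)) lo) , p
      where
      p : c ∷ l ++ d ∷ m ↭ d ∷ m ++ c ∷ l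
      p = ++-comm (c ∷ l) (d ∷ m)

    rotate : (K : Cyc R) → ∀ {d} → d ∈ verts K → ∃ λ m → IsCyc R d m × verts K ↭ d ∷ m
    rotate (cyc K) (here refl) = _ , K , ↭-refl
    rotate (cyc K) (there d∈) with ∈-∃++ d∈
    ... | l , m , refl = _ , rotateAt l K

    nbr-of-cyc : (K : Cyc R) → ∀ {d} → d ∈ verts K → ∃ (R d)
    nbr-of-cyc K d∈ with rotate K d∈
    ... | _ , mkCyc (edge e) _ _ , _ = _ , e
    ... | _ , mkCyc (step e _) _ _ , _ = _ , e

    -- From `x` by `s₂` to `q`, along the arc `m′` to `p`, and back by `s₁` reversed. Of the old
    -- cycle only the arc `m` is lost.
    detour : B.Symmetric R → ∀ {p m q m′ x l₁ l₂} → IsCyc R p (m ++ q ∷ m′) →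
             Seg R x l₁ p → Seg R x l₂ q → Unique (x ∷ l₁ ++ l₂) →
             Disjoint (x ∷ l₁ ++ l₂) (p ∷ m ++ q ∷ m′) →
             IsCyc R x (l₂ ++ q ∷ m′ ++ p ∷ reverse l₁)
    detour sy {p} {m} {q} {m′} {x} {l₁} {l₂} (mkCyc cl un _) s₁ s₂ u d = mkCyc
      (s₂ ++ˢ (proj₂ (splitˢ m cl) ++ˢ reverseˢ sy s₁))
      (Unique-resp-↭ perm (Unique.++⁺ u
        (Unique-∷⁺ (λ p∈ → Unique-∷⁻ un (∈-++⁺ʳ m p∈)) (proj₁ (proj₂ (Unique-++⁻ (p ∷ m) un))))
        λ { (v∈ , here refl) → d (v∈ , here refl)
          ; (v∈ , there w∈)  → d (v∈ , ∈-++⁺ʳ (p ∷ m) w∈) }))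
      (lengths l₂ m′)
      where
      lengths : ∀ l m → 2 ≤ length (l ++ q ∷ m ++ p ∷ reverse l₁)
      lengths (_ ∷ l) m  = ℕ.m≤n⇒m≤1+n (lengths l m)
      lengths [] []      = s≤s (s≤s z≤n)
      lengths [] (_ ∷ _) = s≤s (s≤s z≤n)
      open PermutationReasoning
      perm : (x ∷ l₁ ++ l₂) ++ p ∷ q ∷ m′ ↭ x ∷ l₂ ++ q ∷ m′ ++ p ∷ reverse l₁
      perm = prep x (begin
        (l₁ ++ l₂) ++ p ∷ q ∷ m′            ↭⟨ ++⁺ʳ _ (++-comm l₁ l₂) ⟩
        (l₂ ++ l₁) ++ p ∷ q ∷ m′            ≡⟨ List.++-assoc l₂ l₁ _ ⟩
        l₂ ++ l₁ ++ p ∷ q ∷ m′              ↭⟨ ++⁺ˡ l₂ (shift p l₁ (q ∷ m′)) ⟩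
        l₂ ++ (p ∷ l₁) ++ q ∷ m′            ↭⟨ ++⁺ˡ l₂ (++-comm (p ∷ l₁) (q ∷ m′)) ⟩
        l₂ ++ q ∷ m′ ++ p ∷ l₁              ↭⟨ ++⁺ˡ l₂ (++⁺ˡ (q ∷ m′) (prep p (↭-sym (↭-reverse l₁)))) ⟩
        l₂ ++ q ∷ m′ ++ p ∷ reverse l₁      ∎)

  record Fan (R : Rel V 0ℓ) (x : V) (K : List V) : Set where
    field
      end    : Fin 3 → V
      mid    : Fin 3 → List V
      seg    : ∀ i → Seg R x (mid i) (end i)
      end∈K  : ∀ i → end i ∈ K
      ends≢  : ∀ {i j} → i ≢ j → end i ≢ end j
      mid!   : ∀ i → Unique (mid i)
      x∉mid  : ∀ i → x ∉ mid i
      mid#K  : ∀ i → Disjoint (mid i) K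
      mid#   : ∀ {i j} → i ≢ j → Disjoint (mid i) (mid j)

  fanDetour : ∀ {R : Rel V 0ℓ} → B.Symmetric R → (K : Cyc R) → ∀ {x} → x ∉ verts K →
              (F : Fan R x (verts K)) → let open Fan F in
              ∀ {i j m m′} → i ≢ j → IsCyc R (end i) (m ++ end j ∷ m′) →
              verts K ↭ end i ∷ m ++ end j ∷ m′ →
              Σ[ C ∈ Cyc R ] x ∈ verts C × (∀ {v} → v ∈ verts K → v ∉ m → v ∈ verts C)
  fanDetour sy K {x} x∉K F {i} {j} {m} {m′} i≢j Kᵢ p =
    cyc (detour sy Kᵢ (seg i) (seg j)
          (Unique-∷⁺ x∉ (Unique.++⁺ (mid! i) (mid! j) (mid# i≢j)))
          (λ (v∈ , v∈K) → legs#K v∈ (∈-resp-↭ (↭-sym p) v∈K)))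
    , here refl , λ v∈K v∉m → keep (∈-resp-↭ p v∈K) v∉m
    where
    open Fan F
    x∉ : x ∉ mid i ++ mid j
    x∉ h with ∈-++⁻ (mid i) h
    ... | inj₁ h = x∉mid i h
    ... | inj₂ h = x∉mid j h
    legs#K : ∀ {v} → v ∈ x ∷ mid i ++ mid j → v ∉ verts K
    legs#K (here refl) v∈K = x∉K v∈K
    legs#K (there h) v∈K with ∈-++⁻ (mid i) h
    ... | inj₁ h = mid#K i (h , v∈K)
    ... | inj₂ h = mid#K j (h , v∈K)
    keep : ∀ {v} → v ∈ end i ∷ m ++ end j ∷ m′ → v ∉ m →
           v ∈ x ∷ mid j ++ end j ∷ m′ ++ end i ∷ reverse (mid i)
    keep (here refl) _ = there (∈-++⁺ʳ (mid j) (∈-++⁺ʳ (end j ∷ m′) (here refl)))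
    keep (there h) v∉m with ∈-++⁻ m h
    ... | inj₁ v∈m = ⊥-elim (v∉m v∈m)
    ... | inj₂ h = there (∈-++⁺ʳ (mid j) (∈-++⁺ˡ h))

  -- Deleting s and t cuts D off from the rest; s and t may coincide.
  record Cut (R : Rel V 0ℓ) (D : Pred V 0ℓ) (s t : V) : Set where
    field
      D?     : Decidable D
      s∉D    : ¬ D s
      t∉D    : ¬ D t
      closed : ∀ {u v} → D u → R u v → D v ⊎ (v ≡ s ⊎ v ≡ t)

module _ {n : ℕ} where
  private V = Fin n
  open DecMembership (Fin._≟_ {n}) using (_∈?_)

  module _ {R : Rel V 0ℓ} (R? : B.Decidable R) (irr : B.Irreflexive _≡_ R) where

    private
      module Without (x : V) where
        Keep : Pred (V × V) 0ℓ
        Keep (u , v) = R u v × u ≢ x × v ≢ x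
        keep? : Decidable Keep
        keep? (u , v) = R? u v ×-dec ¬? (u Fin.≟ x) ×-dec ¬? (v Fin.≟ x)
        arcs : List (V × V)
        arcs = filter keep? (cartesianProduct (allFin n) (allFin n))
        arc⁺ : ∀ {u v} → R u v → u ≢ x → v ≢ x → Arc arcs u v
        arc⁺ r p q = ∈-filter⁺ keep? (∈-cartesianProduct⁺ (∈-allFin _) (∈-allFin _)) (r , p , q)
        arc⁻ : ∀ {u v} → Arc arcs u v → Keep (u , v)
        arc⁻ e = proj₂ (∈-filter⁻ keep? {xs = cartesianProduct (allFin n) (allFin n)} e)

        avoid : ∀ {Q a b} → a ≢ x → Walk (Arc arcs) Q a b → Walk R (λ v → Q v × v ≢ x) a b
        avoid a≢ (stop q)     = stop (q , a≢)
        avoid a≢ (step q e w) = let r , _ , c≢ = arc⁻ e in step (q , a≢) r (avoid c≢ w)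

    -- The walk is cut at its first vertex in `P`, and loops are erased from the back: if `a` recurs
    -- in the path already made simple, everything before the recurrence is dropped.
    simplePath : ∀ {P Q : Pred V 0ℓ} → Decidable P → ∀ {x a b} → R x a → Walk R Q a b → P b →
                 ∃₂ λ l e → Seg R x l e × P e × Q e × Unique l × (∀ {v} → v ∈ l → Q v × ¬ P v)
    simplePath P? r (stop {a} q) Pb = [] , a , edge r , Pb , q , [] , λ ()
    simplePath P? {x} r (step {a} q e w) Pb with P? a
    ... | yes Pa = [] , a , edge r , Pa , q , [] , λ ()
    ... | no ¬Pa with simplePath P? e w Pb
    ...   | l , e′ , s , Pe , Qe , u , h with a ∈? l
    ...     | no a∉ = a ∷ l , e′ , step r s , Pe , Qe , Unique-∷⁺ a∉ u ,
                      λ { (here refl) → q , ¬Pa ; (there v∈) → h v∈ }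
    ...     | yes a∈ with ∈-∃++ a∈
    ...       | l₁ , l₂ , refl = a ∷ l₂ , e′ , step r (proj₂ (splitˢ l₁ s)) , Pe , Qe
                               , proj₁ (proj₂ (Unique-++⁻ l₁ u)) , λ v∈ → h (∈-++⁺ʳ l₁ v∈)

    -- Menger's theorem for the neighbours of `x` and `K`, in the graph without the arcs at `x`.
    -- Three disjoint walks become a fan when `x` is put in front; from a separator, `D` is its set
    -- `X` together with `x`.
    fanOrCut : ∀ x {c} K → c ∈ K → x ∉ K →
               Fan R x K ⊎ (∃ λ D → ∃₂ λ s t → Cut R D s t × D x × (∀ {v} → D v → v ∉ K))
    fanOrCut x {c} K c∈K x∉K with menger x 2 (Without.arcs x) (R? x) (_∈? K)
    ... | inj₁ L = inj₁ record
      { end = λ i → proj₁ (proj₂ (leg i))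
      ; mid = λ i → proj₁ (leg i)
      ; seg = λ i → proj₁ (proj₂ (proj₂ (leg i)))
      ; end∈K = λ i → proj₁ (proj₂ (proj₂ (proj₂ (leg i))))
      ; ends≢ = λ {i} {j} i≢j eq → L.disjoint i≢j (proj₁ (end-on i)) (subst (L.on j) (sym eq) (proj₁ (end-on j)))
      ; mid! = λ i → proj₁ (proj₂ (proj₂ (proj₂ (proj₂ (proj₂ (leg i))))))
      ; x∉mid = λ i x∈ → proj₂ (proj₁ (mid-on i x∈)) refl
      ; mid#K = λ i (v∈ , v∈K) → proj₂ (mid-on i v∈) v∈K
      ; mid# = λ {i} {j} i≢j (v∈ , v∈′) → L.disjoint i≢j (proj₁ (proj₁ (mid-on i v∈))) (proj₁ (proj₁ (mid-on j v∈′)))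
      }
      where
      module L = Linkage L
      leg : ∀ i → ∃₂ λ l e → Seg R x l e × e ∈ K × (L.on i e × e ≢ x) × Unique l ×
                             (∀ {v} → v ∈ l → (L.on i v × v ≢ x) × v ∉ K)
      leg i = simplePath (_∈? K) (L.src∈ i)
                (Without.avoid x (λ eq → irr (sym eq) (L.src∈ i)) (L.walk i)) (L.tgt∈ i)
      end-on = λ i → proj₁ (proj₂ (proj₂ (proj₂ (proj₂ (leg i)))))
      mid-on : ∀ i {v} → v ∈ proj₁ (leg i) → (L.on i v × v ≢ x) × v ∉ K
      mid-on i = proj₂ (proj₂ (proj₂ (proj₂ (proj₂ (proj₂ (leg i))))))
    ... | inj₂ sep = inj₂ (D , σ zero , σ (suc zero) , record
      { D? = λ v → (v Fin.≟ x) ⊎-dec S.X? v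
      ; s∉D = σ∉D zero
      ; t∉D = σ∉D (suc zero)
      ; closed = closed }
      , inj₁ refl , D#K)
      where
      module S = Separator sep
      D : Pred V 0ℓ
      D v = v ≡ x ⊎ S.X v
      D#K : ∀ {v} → D v → v ∉ K
      D#K (inj₁ refl) = x∉K
      D#K (inj₂ Xv)   = S.finish Xv
      -- An entry of the separator that equals `x` would lie in `D`. It is replaced by `c`, which
      -- does not, as `D` misses `K`.
      σ : Fin 2 → V
      σ i with S.S i Fin.≟ x
      ... | yes _ = c
      ... | no _  = S.S i
      σ∉D : ∀ i → ¬ D (σ i)
      σ∉D i with S.S i Fin.≟ x
      ... | yes _ = λ h → D#K h c∈K
      ... | no S≢x = λ { (inj₁ eq) → S≢x eq ; (inj₂ Xs) → S.S∉X i Xs }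
      σ-cover : ∀ i → D (S.S i) ⊎ S.S i ≡ σ i
      σ-cover i with S.S i Fin.≟ x
      ... | yes eq = inj₁ (inj₁ eq)
      ... | no _   = inj₂ refl
      cover : ∀ {v} → S.X v ⊎ Image S.S v → D v ⊎ (v ≡ σ zero ⊎ v ≡ σ (suc zero))
      cover (inj₁ Xv) = inj₁ (inj₂ Xv)
      cover (inj₂ (zero , refl)) with σ-cover zero
      ... | inj₁ d = inj₁ d
      ... | inj₂ e = inj₂ (inj₁ e)
      cover (inj₂ (suc zero , refl)) with σ-cover (suc zero)
      ... | inj₁ d = inj₁ d
      ... | inj₂ e = inj₂ (inj₂ e)
      closed : ∀ {u v} → D u → R u v → D v ⊎ (v ≡ σ zero ⊎ v ≡ σ (suc zero))
      closed {u} {v} Du r with v Fin.≟ x | u Fin.≟ x | Du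
      ... | yes eq | _        | _         = inj₁ (inj₁ eq)
      ... | no v≢x | yes refl | _         = cover (S.start r)
      ... | no v≢x | no u≢x   | inj₁ u≡x  = ⊥-elim (u≢x u≡x)
      ... | no v≢x | no u≢x   | inj₂ Xu   = cover (S.closed Xu (Without.arc⁺ x r u≢x v≢x))

-- Rerouting cycles

module _ {V : Set} where

  split₂ : ∀ {p q : V} {l} → p ≢ q → p ∈ l → q ∈ l →
           (∃ λ α → ∃₂ λ β γ → l ≡ α ++ p ∷ β ++ q ∷ γ) ⊎
           (∃ λ α → ∃₂ λ β γ → l ≡ α ++ q ∷ β ++ p ∷ γ)
  split₂ p≢q p∈ q∈ with ∈-∃++ p∈
  ... | α , δ , refl with ∈-++⁻ α q∈
  ...   | inj₂ (here q≡p) = ⊥-elim (p≢q (sym q≡p))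
  ...   | inj₂ (there q∈δ) with ∈-∃++ q∈δ
  ...     | β , γ , refl = inj₁ (α , β , γ , refl)
  split₂ p≢q p∈ q∈ | α , δ , refl | inj₁ q∈α with ∈-∃++ q∈α
  ...     | α₁ , α₂ , refl = inj₂ (α₁ , α₂ , δ , List.++-assoc α₁ _ _)

  record Ordered₃ (e : Fin 3 → V) (l : List V) : Set where
    constructor ordered₃
    field
      {i j k}   : Fin 3
      i≢j       : i ≢ j
      {α β γ δ} : List V
      eq        : l ≡ α ++ e i ∷ β ++ e j ∷ γ ++ e k ∷ δ

  module _ {e : Fin 3 → V} {l} (inj : ∀ {i j} → i ≢ j → e i ≢ e j) (e∈ : ∀ i → e i ∈ l) where

    private
      insert : ∀ {i j α β γ} k → i ≢ j → k ≢ i → k ≢ j → l ≡ α ++ e i ∷ β ++ e j ∷ γ → Ordered₃ e l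
      insert {i} {j} {α} {β} {γ} k i≢j k≢i k≢j refl with ∈-++⁻ α (e∈ k)
      ... | inj₁ k∈α with ∈-∃++ k∈α
      ...   | α₁ , α₂ , refl = ordered₃ k≢i (List.++-assoc α₁ _ _)
      insert {i} {j} {α} {β} {γ} k i≢j k≢i k≢j refl | inj₂ (here eq) = ⊥-elim (inj k≢i eq)
      insert {i} {j} {α} {β} {γ} k i≢j k≢i k≢j refl | inj₂ (there h) with ∈-++⁻ β h
      ... | inj₂ (here eq) = ⊥-elim (inj k≢j eq)
      ... | inj₁ k∈β with ∈-∃++ k∈β
      ...   | β₁ , β₂ , refl = ordered₃ (k≢i ∘ sym) (cong (λ z → α ++ e i ∷ z) (List.++-assoc β₁ _ _))
      insert {i} {j} {α} {β} {γ} k i≢j k≢i k≢j refl | inj₂ (there h) | inj₂ (there k∈γ) with ∈-∃++ k∈γ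
      ...   | γ₁ , γ₂ , refl = ordered₃ i≢j refl

    order₃ : Ordered₃ e l
    order₃ with split₂ (inj {zero} {suc zero} λ ()) (e∈ zero) (e∈ (suc zero))
    ... | inj₁ (_ , _ , _ , eq) = insert (suc (suc zero)) (λ ()) (λ ()) (λ ()) eq
    ... | inj₂ (_ , _ , _ , eq) = insert (suc (suc zero)) (λ ()) (λ ()) (λ ()) eq

  -- For `x` off `K` this excludes the cut in `fanOrCut`, so it provides a fan. In terms of cuts,
  -- rather than paths, it can be carried over to a rerouted cycle.
  NonSep : Rel V 0ℓ → V → List V → Set₁
  NonSep R x K = ∀ {D s t} → Cut R D s t → D x → ∃ λ k → D k × k ∈ K

  ∈⇒NonSep : ∀ {R x K} → x ∈ K → NonSep R x K
  ∈⇒NonSep x∈K _ Dx = _ , Dx , x∈K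

module _ {n : ℕ} {R : Rel (Fin n) 0ℓ} (sy : B.Symmetric R) where
  private V = Fin n
  open Fan
  open DecMembership (Fin._≟_ {n}) using (_∈?_)

  private
    -- The ends of F cut K into three arcs; one of them contains neither w₁ nor w₂.
    avoidArc : (K : Cyc R) → ∀ {x w₁ w₂} → x ∉ verts K → (F : Fan R x (verts K)) → w₁ ∈ verts K → w₂ ∈ verts K →
               ∀ {i j k m₁ m₂ m₃} → i ≢ j → j ≢ k → k ≢ i →
               IsCyc R (end F i) (m₁ ++ end F j ∷ m₂ ++ end F k ∷ m₃) →
               verts K ↭ end F i ∷ m₁ ++ end F j ∷ m₂ ++ end F k ∷ m₃ →
               Σ[ C ∈ Cyc R ] x ∈ verts C × w₁ ∈ verts C × w₂ ∈ verts C
    avoidArc K {x} {w₁} {w₂} x∉K F w₁∈ w₂∈ {i} {j} {k} {m₁} {m₂} {m₃} i≢j j≢k k≢i Kᵢ p = choose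
      where
      e = end F
      Goal = Σ[ C ∈ Cyc R ] x ∈ verts C × w₁ ∈ verts C × w₂ ∈ verts C

      drop : ∀ {i j m m′} → i ≢ j → IsCyc R (e i) (m ++ e j ∷ m′) → verts K ↭ e i ∷ m ++ e j ∷ m′ →
             w₁ ∉ m → w₂ ∉ m → Goal
      drop i≢j Kᵢ p w₁∉ w₂∉ = let C , x∈ , keep = fanDetour sy K x∉K F i≢j Kᵢ p
                              in C , x∈ , keep w₁∈ w₁∉ , keep w₂∈ w₂∉

      drop₁ : w₁ ∉ m₁ → w₂ ∉ m₁ → Goal
      drop₁ = drop {i} {j} {m₁} i≢j Kᵢ p

      drop₂ : w₁ ∉ m₂ → w₂ ∉ m₂ → Goal
      drop₂ = let Kⱼ , q = rotateAt m₁ Kᵢ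
                  eq = List.++-assoc m₂ (e k ∷ m₃) (e i ∷ m₁)
              in drop {j} {k} {m₂} j≢k (subst (IsCyc R (e j)) eq Kⱼ)
                   (↭-trans p (↭-trans q (↭-reflexive (cong (e j ∷_) eq))))

      drop₃ : w₁ ∉ m₃ → w₂ ∉ m₃ → Goal
      drop₃ = let eq = sym (List.++-assoc m₁ (e j ∷ m₂) (e k ∷ m₃))
                  Kₖ , q = rotateAt (m₁ ++ e j ∷ m₂) (subst (IsCyc R (e i)) eq Kᵢ)
              in drop {k} {i} {m₃} k≢i Kₖ (↭-trans p (↭-trans (↭-reflexive (cong (e i ∷_) eq)) q))

      m₁# : Disjoint m₁ (e j ∷ m₂ ++ e k ∷ m₃)
      m₁# = proj₂ (proj₂ (Unique-++⁻ m₁ (proj₁ (proj₂ (Unique-++⁻ (e i ∷ []) (IsCyc.unique Kᵢ))))))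
      m₂# : Disjoint m₂ (e k ∷ m₃)
      m₂# = proj₂ (proj₂ (Unique-++⁻ m₂ (proj₁ (proj₂ (Unique-++⁻ (e i ∷ m₁ ++ e j ∷ [])
              (subst Unique (sym (List.++-assoc (e i ∷ m₁) (e j ∷ []) _)) (IsCyc.unique Kᵢ)))))))
      m₁∌ : ∀ {w} → w ∈ m₁ → w ∉ m₃
      m₁∌ h h′ = m₁# (h , ∈-++⁺ʳ (e j ∷ m₂) (there h′))
      m₁₂ : ∀ {w} → w ∈ m₁ → w ∉ m₂
      m₁₂ h h′ = m₁# (h , there (∈-++⁺ˡ h′))
      m₂∌ : ∀ {w} → w ∈ m₂ → w ∉ m₃
      m₂∌ h h′ = m₂# (h , there h′)

      choose : Goal
      -- The arcs are disjoint. If neither `m₁` nor `m₂` is free of `w₁` and `w₂`, each of them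
      -- holds exactly one, and `m₃` is free.
      choose with w₁ ∈? m₁ | w₂ ∈? m₁ | w₁ ∈? m₂ | w₂ ∈? m₂
      ... | no a  | no b  | _     | _     = drop₁ a b
      ... | _     | _     | no a  | no b  = drop₂ a b
      ... | yes a | _     | yes b | _     = ⊥-elim (m₁₂ a b)
      ... | _     | yes a | _     | yes b = ⊥-elim (m₁₂ a b)
      ... | yes a | _     | _     | yes b = drop₃ (m₁∌ a) (m₂∌ b)
      ... | _     | yes a | yes b | _     = drop₃ (m₂∌ b) (m₁∌ a)

  reroute : (K : Cyc R) → ∀ {x w₁ w₂} → x ∉ verts K → Fan R x (verts K) → w₁ ∈ verts K → w₂ ∈ verts K →
            Σ[ C ∈ Cyc R ] x ∈ verts C × w₁ ∈ verts C × w₂ ∈ verts C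
  reroute K {x} {w₁} {w₂} x∉K F w₁∈ w₂∈ with rotate K (end∈K F zero)
  ... | m , K₀ , p with split₂ (ends≢ F {suc zero} {suc (suc zero)} λ ())
                              (rest∈ (suc zero) λ ()) (rest∈ (suc (suc zero)) λ ())
    where
    rest∈ : ∀ i → i ≢ zero → end F i ∈ m
    rest∈ i i≢0 with ∈-resp-↭ p (end∈K F i)
    ... | here eq = ⊥-elim (ends≢ F i≢0 eq)
    ... | there h = h
  ...   | inj₁ (m₁ , _ , _ , refl) = avoidArc K x∉K F w₁∈ w₂∈ {m₁ = m₁} (λ ()) (λ ()) (λ ()) K₀ p
  ...   | inj₂ (m₁ , _ , _ , refl) = avoidArc K x∉K F w₁∈ w₂∈ {m₁ = m₁} (λ ()) (λ ()) (λ ()) K₀ p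

-- Cycles that cross a cut of two vertices

module _ {n : ℕ} where
  private V = Fin n
  open DecMembership (Fin._≟_ {n}) using (_∈?_)

  Within Beyond : Pred V 0ℓ → V → V → Pred V 0ℓ
  Within D s t v = D v ⊎ (v ≡ s ⊎ v ≡ t)
  Beyond D s t v = ¬ Within D s t v

  module _ {R : Rel V 0ℓ} {D s t} (cut : Cut R D s t) where
    open Cut cut

    crossesCut : ∀ {a l b} → Seg R a l b → Within D s t a → Beyond D s t b → s ∈ a ∷ l ⊎ t ∈ a ∷ l
    crossesCut _ (inj₂ (inj₁ refl)) _ = inj₁ (here refl)
    crossesCut _ (inj₂ (inj₂ refl)) _ = inj₂ (here refl)
    crossesCut {l = l} sg (inj₁ Da) beyond with s ∈? l | t ∈? l
    ... | yes s∈ | _      = inj₁ (there s∈)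
    ... | no _   | yes t∈ = inj₂ (there t∈)
    ... | no s∉  | no t∉  = ⊥-elim (beyond (proj₂ (stay closed sg Da
                              λ { v∈ (inj₁ refl) → s∉ v∈ ; v∈ (inj₂ refl) → t∉ v∈ })))

    exit : ∀ {a l b} → Seg R a l b → D a → Beyond D s t b → s ∈ l ⊎ t ∈ l
    exit sg Da beyond with crossesCut sg (inj₁ Da) beyond
    ... | inj₁ (here refl) = ⊥-elim (s∉D Da)
    ... | inj₂ (here refl) = ⊥-elim (t∉D Da)
    ... | inj₁ (there s∈)  = inj₁ s∈
    ... | inj₂ (there t∈)  = inj₂ t∈

    -- Each of the two arcs of `K` between `k` and `y` leaves `D` through `s` or `t`. The arcs have
    -- no inner vertex in common, so one uses `s` and the other `t`.
    straddle : B.Symmetric R → (K : Cyc R) → ∀ {k y} → k ∈ verts K → D k → y ∈ verts K → Beyond D s t y →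
               s ∈ verts K × t ∈ verts K
    straddle sy K k∈ Dk y∈ beyond with rotate K k∈
    ... | m , mkCyc cl un _ , p with ∈-resp-↭ p y∈
    ...   | here refl = ⊥-elim (beyond (inj₁ Dk))
    ...   | there y∈m with ∈-∃++ y∈m
    ...     | α , β , refl = back (combine (exit (proj₁ (splitˢ α cl)) Dk beyond)
                                           (exit (reverseˢ sy (proj₂ (splitˢ α cl))) Dk beyond))
      where
      α#β : Disjoint α (_ ∷ β)
      α#β = proj₂ (proj₂ (Unique-++⁻ α (proj₁ (proj₂ (Unique-++⁻ (_ ∷ []) un)))))
      unrev : ∀ {v} → v ∈ reverse β → v ∈ β
      unrev = ∈-resp-↭ (↭-reverse β)
      back : _ → _
      back (s∈ , t∈) = ∈-resp-↭ (↭-sym p) (there s∈) , ∈-resp-↭ (↭-sym p) (there t∈)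
      combine : s ∈ α ⊎ t ∈ α → s ∈ reverse β ⊎ t ∈ reverse β → s ∈ α ++ _ ∷ β × t ∈ α ++ _ ∷ β
      combine (inj₁ s∈) (inj₂ t∈)  = ∈-++⁺ˡ s∈ , ∈-++⁺ʳ α (there (unrev t∈))
      combine (inj₂ t∈) (inj₁ s∈)  = ∈-++⁺ʳ α (there (unrev s∈)) , ∈-++⁺ˡ t∈
      combine (inj₁ s∈) (inj₁ s∈′) = ⊥-elim (α#β (s∈ , there (unrev s∈′)))
      combine (inj₂ t∈) (inj₂ t∈′) = ⊥-elim (α#β (t∈ , there (unrev t∈′)))

-- Three vertices on a cycle

module _ {n : ℕ} {R : Rel (Fin n) 0ℓ} (sy : B.Symmetric R) (R? : B.Decidable R) (irr : B.Irreflexive _≡_ R) where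
  private V = Fin n
  open Fan
  open DecMembership (Fin._≟_ {n}) using (_∈?_)

  fan : (K : Cyc R) → ∀ {x} → x ∉ verts K → NonSep R x (verts K) → Fan R x (verts K)
  fan K x∉K ns with fanOrCut R? irr _ (verts K) (here refl) x∉K
  ... | inj₁ F = F
  ... | inj₂ (_ , _ , _ , cut , Dx , D#K) = let _ , Dk , k∈K = ns cut Dx in ⊥-elim (D#K Dk k∈K)

  otherSide : ∀ {D s t} → Cut R D s t → Cut R (Beyond D s t) s t
  otherSide {D} {s} {t} cut = record
    { D? = λ v → ¬? (D? v ⊎-dec ((v Fin.≟ s) ⊎-dec (v Fin.≟ t)))
    ; s∉D = λ h → h (inj₂ (inj₁ refl))
    ; t∉D = λ h → h (inj₂ (inj₂ refl))
    ; closed = cl }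
    where
    open Cut cut
    cl : ∀ {u v} → Beyond D s t u → R u v → Beyond D s t v ⊎ (v ≡ s ⊎ v ≡ t)
    cl {u} {v} ¬Tu r with (v Fin.≟ s) ⊎-dec (v Fin.≟ t)
    ... | yes st = inj₂ st
    ... | no ¬st = inj₁ λ { (inj₁ Dv) → ¬Tu (closed Dv (sy r)) ; (inj₂ st) → ¬st st }

  record Absorbed (K : Cyc R) (x : V) (D : Pred V 0ℓ) : Set₁ where
    field
      K′     : Cyc R
      x∈K′   : x ∈ verts K′
      keep   : ∀ {v} → v ∈ verts K → ¬ D v → v ∈ verts K′
      nonSep : ∀ {v} → ¬ D v → NonSep R v (verts K) → NonSep R v (verts K′)

  module _ {D s t} (cut : Cut R D s t) where
    open Cut cut

    -- If `D′` contains `s` or `t`, that vertex is on the new cycle. Otherwise no vertex of `D′`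
    -- outside `D` is adjacent to `D`, so `D′` without `D` is itself cut off by `s′` and `t′`. It
    -- then has a vertex on `K`, which is kept because it is not in `D`.
    nonSep-outside : ∀ {K K′} → s ∈ K → t ∈ K → (∀ {v} → v ∈ K → ¬ D v → v ∈ K′) →
                     ∀ {v} → ¬ D v → NonSep R v K → NonSep R v K′
    nonSep-outside s∈ t∈ keep ¬Dv ns {D′} {s′} {t′} cut′ D′v with Cut.D? cut′ s | Cut.D? cut′ t
    ... | yes D′s | _       = s , D′s , keep s∈ s∉D
    ... | no _    | yes D′t = t , D′t , keep t∈ t∉D
    ... | no ¬D′s | no ¬D′t = let k , (D′k , ¬Dk) , k∈ = ns minus (D′v , ¬Dv) in k , D′k , keep k∈ ¬Dk
      where
      module C′ = Cut cut′
      minus : Cut R (λ v → D′ v × ¬ D v) s′ t′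
      minus = record
        { D? = λ v → C′.D? v ×-dec ¬? (D? v) ; s∉D = C′.s∉D ∘ proj₁ ; t∉D = C′.t∉D ∘ proj₁ ; closed = cl }
        where
        cl : ∀ {u v} → D′ u × ¬ D u → R u v → (D′ v × ¬ D v) ⊎ (v ≡ s′ ⊎ v ≡ t′)
        cl {u} {v} (D′u , ¬Du) r with C′.closed D′u r | D? v
        ... | inj₂ st  | _      = inj₂ st
        ... | inj₁ D′v | no ¬Dv = inj₁ (D′v , ¬Dv)
        ... | inj₁ D′v | yes Dv with closed Dv (sy r)
        ...   | inj₁ Du          = ⊥-elim (¬Du Du)
        ...   | inj₂ (inj₁ refl) = ⊥-elim (¬D′s D′u)
        ...   | inj₂ (inj₂ refl) = ⊥-elim (¬D′t D′u)

    private
      module _ (K : Cyc R) {x y} (x∉K : x ∉ verts K) (ns : NonSep R x (verts K)) (Dx : D x)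
               (y∈K : y ∈ verts K) (¬Ty : Beyond D s t y) where

        F : Fan R x (verts K)
        F = fan K x∉K ns

        s,t∈K : s ∈ verts K × t ∈ verts K
        s,t∈K = let _ , Dk , k∈K = ns cut Dx in straddle cut sy K k∈K Dk y∈K ¬Ty

        -- The legs of the fan start in `D` and could leave it only through `s` or `t`; these are on
        -- `K`, which a leg meets only at its end.
        end∈T : ∀ i → Within D s t (end F i)
        end∈T i = proj₂ (stay closed (seg F i) Dx
          λ { v∈ (inj₁ refl) → mid#K F i (v∈ , proj₁ s,t∈K) ; v∈ (inj₂ refl) → mid#K F i (v∈ , proj₂ s,t∈K) })

    -- K crosses from y into D and back only through s and t, so two of the ends
    -- of a fan from x bound an arc of K inside D.
    absorb : (K : Cyc R) → ∀ {x y} → x ∉ verts K → NonSep R x (verts K) → D x →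
             y ∈ verts K → Beyond D s t y → Absorbed K x D
    absorb K {x} {y} x∉K ns Dx y∈K ¬Ty with rotate K y∈K
    ... | l , K₀ , π with order₃ {e = end (F K x∉K ns Dx y∈K ¬Ty)} (ends≢ (F K x∉K ns Dx y∈K ¬Ty)) end∈l
      where
      end∈l : ∀ i → end (F K x∉K ns Dx y∈K ¬Ty) i ∈ l
      end∈l i with ∈-resp-↭ π (end∈K (F K x∉K ns Dx y∈K ¬Ty) i)
      ... | here eq = ⊥-elim (¬Ty (subst (Within D s t) eq (end∈T K x∉K ns Dx y∈K ¬Ty i)))
      ... | there h = h
    ...   | ordered₃ {i} {j} {k} i≢j {α} {β} {γ} {δ} refl = record
      { K′ = K′ ; x∈K′ = proj₁ (proj₂ new) ; keep = keep
      ; nonSep = nonSep-outside (proj₁ st∈K) (proj₂ st∈K) keep }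
      where
      F₀ = F K x∉K ns Dx y∈K ¬Ty
      st∈K = s,t∈K K x∉K ns Dx y∈K ¬Ty
      end∈ = end∈T K x∉K ns Dx y∈K ¬Ty
      p = end F₀ i ; q = end F₀ j ; r = end F₀ k
      Kᵢ : IsCyc R p ((β ++ q ∷ γ ++ r ∷ δ) ++ y ∷ α)
      Kᵢ = proj₁ (rotateAt α K₀)
      eq : (β ++ q ∷ γ ++ r ∷ δ) ++ y ∷ α ≡ β ++ q ∷ (γ ++ r ∷ δ) ++ y ∷ α
      eq = List.++-assoc β _ _
      new = fanDetour sy K x∉K F₀ {i} {j} {β} i≢j (subst (IsCyc R p) eq Kᵢ)
              (↭-trans π (↭-trans (proj₂ (rotateAt α K₀)) (↭-reflexive (cong (p ∷_) eq))))
      K′ = proj₁ new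
      yα  = proj₁ (splitˢ α (IsCyc.closed K₀))
      pβ… = proj₂ (splitˢ α (IsCyc.closed K₀))
      pβq = proj₁ (splitˢ β pβ…)
      rδy = proj₂ (splitˢ γ (proj₂ (splitˢ β pβ…)))
      u₀ : Unique (α ++ p ∷ β ++ q ∷ γ ++ r ∷ δ)
      u₀ = proj₁ (proj₂ (Unique-++⁻ (y ∷ []) (IsCyc.unique K₀)))
      u₁ : Unique ((p ∷ α) ++ (β ++ q ∷ γ ++ r ∷ δ))
      u₁ = Unique-resp-↭ (shift p α _) u₀
      pα# : Disjoint (p ∷ α) (β ++ q ∷ γ ++ r ∷ δ)
      pα# = proj₂ (proj₂ (Unique-++⁻ (p ∷ α) u₁))
      βq# : Disjoint (β ++ q ∷ []) (γ ++ r ∷ δ)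
      βq# = proj₂ (proj₂ (Unique-++⁻ (β ++ q ∷ []) (subst Unique (sym (List.++-assoc β (q ∷ []) _))
              (proj₁ (proj₂ (Unique-++⁻ (p ∷ α) u₁))))))
      rδ⊆ : ∀ {v} → v ∈ r ∷ δ → v ∈ γ ++ r ∷ δ
      rδ⊆ = ∈-++⁺ʳ γ
      unrev : ∀ {v} → v ∈ p ∷ reverse α → v ∈ p ∷ α
      unrev = ∈-resp-↭ (prep p (↭-reverse α))
      before : s ∈ p ∷ α ⊎ t ∈ p ∷ α
      before with crossesCut cut (reverseˢ sy yα) (end∈ i) ¬Ty
      ... | inj₁ h = inj₁ (unrev h)
      ... | inj₂ h = inj₂ (unrev h)
      after : s ∈ r ∷ δ ⊎ t ∈ r ∷ δ
      after = crossesCut cut rδy (end∈ k) ¬Ty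
      βq⊆ : ∀ {v} → v ∈ β ++ q ∷ [] → v ∈ β ++ q ∷ γ ++ r ∷ δ
      βq⊆ h with ∈-++⁻ β h
      ... | inj₁ h = ∈-++⁺ˡ h
      ... | inj₂ (here eq) = ∈-++⁺ʳ β (here eq)
      far : ∀ {v} → v ∈ p ∷ α → v ∉ r ∷ δ
      far h h′ = pα# (h , ∈-++⁺ʳ β (there (rδ⊆ h′)))
      -- One of `s` and `t` is between `y` and `p`, the other between `r` and `y`, with `p` and `r`
      -- included. Neither is left for `β` and `q`.
      βq∌st : ∀ {v} → v ∈ β ++ q ∷ [] → ¬ (v ≡ s ⊎ v ≡ t)
      βq∌st h st with before | after
      βq∌st h (inj₁ refl) | inj₁ s∈ | _       = pα# (s∈ , βq⊆ h)
      βq∌st h (inj₂ refl) | inj₂ t∈ | _       = pα# (t∈ , βq⊆ h)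
      βq∌st h (inj₁ refl) | _       | inj₁ s∈ = βq# (h , rδ⊆ s∈)
      βq∌st h (inj₂ refl) | _       | inj₂ t∈ = βq# (h , rδ⊆ t∈)
      βq∌st h (inj₂ refl) | inj₁ s∈ | inj₁ s∈′ = far s∈ s∈′
      βq∌st h (inj₁ refl) | inj₂ t∈ | inj₂ t∈′ = far t∈ t∈′
      -- This is where the third leg counts: `p` and `r` may be `s` and `t`, but the middle end is
      -- in `D`.
      Dq : D q
      Dq with end∈ j
      ... | inj₁ Dq = Dq
      ... | inj₂ st = ⊥-elim (βq∌st (∈-++⁺ʳ β (here refl)) st)
      β⊆D : ∀ {v} → v ∈ β → D v
      β⊆D h = proj₁ (stay closed (reverseˢ sy pβq) Dq (λ h → βq∌st (∈-++⁺ˡ (∈-resp-↭ (↭-reverse β) h))))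
                (∈-resp-↭ (↭-sym (↭-reverse β)) h)
      keep : ∀ {v} → v ∈ verts K → ¬ D v → v ∈ verts K′
      keep v∈K ¬Dv = proj₂ (proj₂ new) v∈K (λ v∈β → ¬Dv (β⊆D v∈β))

  CutOff : Cyc R → Cyc R → V → Set₁
  CutOff K C x = ∃ λ D → ∃₂ λ s t → Cut R D s t × D x × (∀ {v} → D v → v ∉ verts C) ×
                 ∃ λ y → y ∈ verts K × Beyond D s t y

  -- One of the three vertices differs from `s` and `t`, and as a vertex of `C` it is not in `D`.
  -- `NonSep`, applied to the other side of the cut, then finds the vertex of `K` beyond the cut
  -- that `absorb` asks for.
  fanOrCutOff : (K C : Cyc R) → ∀ {x a b c} → x ∉ verts C → a ≢ b → a ≢ c → b ≢ c →
                a ∈ verts C → b ∈ verts C → c ∈ verts C →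
                NonSep R a (verts K) → NonSep R b (verts K) → NonSep R c (verts K) →
                Fan R x (verts C) ⊎ CutOff K C x
  fanOrCutOff K C {x} {a} {b} {c} x∉C a≢b a≢c b≢c a∈ b∈ c∈ nsa nsb nsc
    with fanOrCut R? irr x (verts C) (here refl) x∉C
  ... | inj₁ F = inj₁ F
  ... | inj₂ (D , s , t , cut , Dx , D#C) = inj₂ (D , s , t , cut , Dx , D#C , y)
    where
    beyond : ∀ {w} → w ∈ verts C → NonSep R w (verts K) → w ≢ s → w ≢ t → ∃ λ y → y ∈ verts K × Beyond D s t y
    beyond {w} w∈ ns w≢s w≢t = let k , Ok , k∈ = ns (otherSide cut) ¬Tw in k , k∈ , Ok
      where
      ¬Tw : Beyond D s t w
      ¬Tw (inj₁ Dw)       = D#C Dw w∈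
      ¬Tw (inj₂ (inj₁ e)) = w≢s e
      ¬Tw (inj₂ (inj₂ e)) = w≢t e
    y : ∃ λ y → y ∈ verts K × Beyond D s t y
    y with a Fin.≟ s | a Fin.≟ t | b Fin.≟ s | b Fin.≟ t
    ... | no p     | no q     | _        | _        = beyond a∈ nsa p q
    ... | _        | _        | no p     | no q     = beyond b∈ nsb p q
    ... | yes refl | _        | yes e    | _        = ⊥-elim (a≢b (sym e))
    ... | _        | yes refl | _        | yes e    = ⊥-elim (a≢b (sym e))
    ... | yes refl | _        | _        | yes refl = beyond c∈ nsc (a≢c ∘ sym) (b≢c ∘ sym)
    ... | _        | yes refl | yes refl | _        = beyond c∈ nsc (b≢c ∘ sym) (a≢c ∘ sym)

  Through : V → V → V → Set
  Through a b c = Σ[ C ∈ Cyc R ] a ∈ verts C × b ∈ verts C × c ∈ verts C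

  through-two : (K : Cyc R) → ∀ {a b c} → a ∈ verts K → b ∈ verts K → NonSep R c (verts K) → Through a b c
  through-two K {c = c} a∈ b∈ ns with c ∈? verts K
  ... | yes c∈ = K , a∈ , b∈ , c∈
  ... | no c∉ = let C , c∈ , a∈ , b∈ = reroute sy K c∉ (fan K c∉ ns) a∈ b∈ in C , a∈ , b∈ , c∈

  otherVertex : (K : Cyc R) → ∀ a → ∃ λ w → w ∈ verts K × w ≢ a
  otherVertex (cyc {c} {[]} (mkCyc _ _ ())) a
  otherVertex (cyc {c} {d ∷ l} (mkCyc _ un _)) a with c Fin.≟ a
  ... | no c≢a = c , here refl , c≢a
  ... | yes refl = d , there (here refl) , λ { refl → Unique-∷⁻ un (here refl) }

  -- If `c` is cut off from a cycle `C` through `a` and `b`, then `c` is absorbed into `K` instead.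
  -- As `a` and `b` are on `C`, they are outside `D`: the new cycle still contains `a`, and `b`
  -- keeps `NonSep`. Now two of the three are on the cycle.
  through-one : (K : Cyc R) → ∀ {a b c} → a ≢ b → a ≢ c → b ≢ c → a ∈ verts K →
                NonSep R b (verts K) → NonSep R c (verts K) → Through a b c
  through-one K {a} {b} {c} a≢b a≢c b≢c a∈ nsb nsc with b ∈? verts K
  ... | yes b∈ = through-two K a∈ b∈ nsc
  -- `w` is carried along to give `C` a third vertex for `fanOrCutOff`.
  ... | no b∉ with otherVertex K a
  ...   | w , w∈ , w≢a with reroute sy K b∉ (fan K b∉ nsb) a∈ w∈
  ...     | C , b∈C , a∈C , w∈C with c ∈? verts C
  ...       | yes c∈C = C , a∈C , b∈C , c∈C
  ...       | no c∉C with fanOrCutOff K C c∉C a≢b (w≢a ∘ sym) (λ { refl → b∉ w∈ }) a∈C b∈C w∈C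
                          (∈⇒NonSep a∈) nsb (∈⇒NonSep w∈)
  ...         | inj₁ F = let C′ , c∈ , a∈ , b∈ = reroute sy C c∉C F a∈C b∈C in C′ , a∈ , b∈ , c∈
  ...         | inj₂ (D , s , t , cut , Dc , D#C , y , y∈ , ¬Ty) with c ∈? verts K
  ...           | yes c∈ = let C′ , a∈ , c∈ , b∈ = through-two K a∈ c∈ nsb in C′ , a∈ , b∈ , c∈
  ...           | no c∉ = let open Absorbed (absorb cut K c∉ nsc Dc y∈ ¬Ty)
                              C′ , a∈ , c∈ , b∈ = through-two K′ (keep a∈ (λ Da → D#C Da a∈C)) x∈K′
                                                    (nonSep (λ Db → D#C Db b∈C) nsb)
                          in C′ , a∈ , b∈ , c∈

  throughThree : (K : Cyc R) → ∀ {a b c} → a ≢ b → a ≢ c → b ≢ c →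
                 NonSep R a (verts K) → NonSep R b (verts K) → NonSep R c (verts K) → Through a b c
  throughThree K {a} {b} {c} a≢b a≢c b≢c nsa nsb nsc with a ∈? verts K | b ∈? verts K | c ∈? verts K
  ... | yes a∈ | _ | _ = through-one K a≢b a≢c b≢c a∈ nsb nsc
  ... | _ | yes b∈ | _ = let C , b∈ , a∈ , c∈ = through-one K (a≢b ∘ sym) b≢c a≢c b∈ nsa nsc in C , a∈ , b∈ , c∈
  ... | _ | _ | yes c∈ = let C , c∈ , a∈ , b∈ = through-one K (a≢c ∘ sym) (b≢c ∘ sym) a≢b c∈ nsa nsb in C , a∈ , b∈ , c∈
  ... | no a∉ | no b∉ | no c∉ = viaA (reroute sy K a∉ (fan K a∉ nsa) (here refl) (proj₁ (proj₂ other)))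
    where
    w₁ = Cyc.base K
    other = otherVertex K w₁
    w₂ = proj₁ other
    out : ∀ {v w} → v ∉ verts K → w ∈ verts K → v ≢ w
    out v∉ w∈ refl = v∉ w∈

    fromB : (K′ : Cyc R) → b ∈ verts K′ → NonSep R a (verts K′) → NonSep R c (verts K′) → Through a b c
    fromB K′ b∈ nsa nsc = let C , b∈ , a∈ , c∈ = through-one K′ (a≢b ∘ sym) b≢c a≢c b∈ nsa nsc in C , a∈ , b∈ , c∈

    -- w₁ is kept on C₁ so that C₁ has a third vertex not separable from K.
    viaC : (C₁ : Cyc R) → a ∈ verts C₁ → b ∈ verts C₁ → w₁ ∈ verts C₁ → Through a b c
    viaC C₁ a∈ b∈ w∈ with c ∈? verts C₁
    ... | yes c∈ = C₁ , a∈ , b∈ , c∈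
    ... | no c∉C with fanOrCutOff K C₁ c∉C a≢b (out a∉ (here refl)) (out b∉ (here refl)) a∈ b∈ w∈
                      nsa nsb (∈⇒NonSep (here refl))
    ...   | inj₁ F = let C′ , c∈ , a∈ , b∈ = reroute sy C₁ c∉C F a∈ b∈ in C′ , a∈ , b∈ , c∈
    ...   | inj₂ (D , s , t , cut , Dc , D#C , y , y∈ , ¬Ty) =
      let open Absorbed (absorb cut K c∉ nsc Dc y∈ ¬Ty)
          C , c∈ , a∈ , b∈ = through-one K′ (a≢c ∘ sym) (b≢c ∘ sym) a≢b x∈K′
                               (nonSep (λ Da → D#C Da a∈) nsa) (nonSep (λ Db → D#C Db b∈) nsb)
      in C , a∈ , b∈ , c∈

    viaA : (Σ[ C ∈ Cyc R ] a ∈ verts C × w₁ ∈ verts C × w₂ ∈ verts C) → Through a b c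
    viaA (C₀ , a∈ , w₁∈ , w₂∈) with b ∈? verts C₀
    ... | yes b∈ = viaC C₀ a∈ b∈ w₁∈
    ... | no b∉C with fanOrCutOff K C₀ b∉C (out a∉ (here refl)) (out a∉ (proj₁ (proj₂ other)))
                      (proj₂ (proj₂ other) ∘ sym) a∈ w₁∈ w₂∈
                      nsa (∈⇒NonSep (here refl)) (∈⇒NonSep (proj₁ (proj₂ other)))
    ...   | inj₁ F = let C₁ , b∈ , a∈ , w∈ = reroute sy C₀ b∉C F a∈ w₁∈ in viaC C₁ a∈ b∈ w∈
    ...   | inj₂ (D , s , t , cut , Db , D#C , y , y∈ , ¬Ty) with Cut.D? cut c
    ...     | no ¬Dc = let open Absorbed (absorb cut K b∉ nsb Db y∈ ¬Ty)
                       in fromB K′ x∈K′ (nonSep (λ Da → D#C Da a∈) nsa) (nonSep ¬Dc nsc)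
    -- With `c` in `D`, absorbing `b` there could destroy `NonSep` for `c`. Instead `a` is absorbed
    -- on the other side of the cut, which contains neither `b` nor `c`. It lies there because it is
    -- on `C₀` and not on `K`, whereas `s` and `t` are on `K`.
    ...     | yes Dc = through-one K′ a≢b a≢c b≢c x∈K′ (nonSep (λ h → h (inj₁ Db)) nsb) (nonSep (λ h → h (inj₁ Dc)) nsc)
      where
      k = nsb cut Db
      s,t∈K : s ∈ verts K × t ∈ verts K
      s,t∈K = straddle cut sy K (proj₂ (proj₂ k)) (proj₁ (proj₂ k)) y∈ ¬Ty
      beyondA : Beyond D s t a
      beyondA (inj₁ Da)          = D#C Da a∈
      beyondA (inj₂ (inj₁ refl)) = a∉ (proj₁ s,t∈K)
      beyondA (inj₂ (inj₂ refl)) = a∉ (proj₂ s,t∈K)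
      beyondK : Beyond (Beyond D s t) s t (proj₁ k)
      beyondK (inj₁ ¬Tk)         = ¬Tk (inj₁ (proj₁ (proj₂ k)))
      beyondK (inj₂ (inj₁ eq))   = Cut.s∉D cut (subst D eq (proj₁ (proj₂ k)))
      beyondK (inj₂ (inj₂ eq))   = Cut.t∉D cut (subst D eq (proj₁ (proj₂ k)))
      open Absorbed (absorb (otherSide cut) K a∉ nsa beyondA (proj₂ (proj₂ k)) beyondK)

-- Facial cycles

mod-unique : ∀ {a b n} .{{_ : NonZero n}} → a % n ≡ b % n → a ≤ b → b < a + n → a ≡ b
mod-unique {a} {b} {n} eq a≤b b<a+n with ℕ.<-cmp (a / n) (b / n)
... | B.tri≈ _ q _ = trans (m≡m%n+[m/n]*n a n) (trans (Eq.cong₂ (λ r q → r + q * n) eq q) (sym (m≡m%n+[m/n]*n b n)))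
... | B.tri> _ _ q> = ℕ.≤-antisym a≤b (subst (b ≤_) (sym (m≡m%n+[m/n]*n a n))
    (subst (_≤ a % n + a / n * n) (sym (m≡m%n+[m/n]*n b n))
      (ℕ.+-mono-≤ (ℕ.≤-reflexive (sym eq)) (ℕ.*-monoˡ-≤ n (ℕ.<⇒≤ q>)))))
... | B.tri< q< _ _ = ⊥-elim (ℕ.<⇒≱ b<a+n (begin
    a + n                      ≡⟨ cong (_+ n) (m≡m%n+[m/n]*n a n) ⟩
    a % n + a / n * n + n      ≡⟨ ℕ.+-assoc (a % n) _ n ⟩
    a % n + (a / n * n + n)    ≡⟨ cong (a % n +_) (ℕ.+-comm _ n) ⟩
    a % n + suc (a / n) * n    ≤⟨ ℕ.+-mono-≤ (ℕ.≤-reflexive eq) (ℕ.*-monoˡ-≤ n q<) ⟩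
    b % n + b / n * n          ≡⟨ m≡m%n+[m/n]*n b n ⟨
    b                          ∎))
  where open ℕ.≤-Reasoning

toℕ-mod : ∀ k n .{{_ : NonZero n}} → toℕ (k mod n) ≡ k % n
toℕ-mod k n = Fin.toℕ-fromℕ< (m%n<n k n)

mod-cong : ∀ {a b n} .{{_ : NonZero n}} → a % n ≡ b % n → a mod n ≡ b mod n
mod-cong {a} {b} {n} eq = Fin.toℕ-injective (trans (toℕ-mod a n) (trans eq (sym (toℕ-mod b n))))

next-mod : ∀ k {n} .{{_ : NonZero n}} → next (k mod n) ≡ suc k mod n
next-mod k {n} = mod-cong {suc (toℕ (k mod n))} {suc k} (begin
    suc (toℕ (k mod n)) % n          ≡⟨ cong (λ z → suc z % n) (toℕ-mod k n) ⟩
    (1 + k % n) % n                  ≡⟨ %-distribˡ-+ 1 (k % n) n ⟩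
    (1 % n + k % n % n) % n          ≡⟨ cong (λ z → (1 % n + z) % n) (m%n%n≡m%n k n) ⟩
    (1 % n + k % n) % n              ≡⟨ %-distribˡ-+ 1 k n ⟨
    suc k % n                        ∎)
  where open Eq.≡-Reasoning

-- Unrolls the cyclic order at `i`, so that positions compare as natural numbers: an index before
-- `i` is taken one period later.
window : ∀ {n} .{{_ : NonZero n}} (i j : Fin n) →
         ∃ λ c → toℕ i ≤ c × c < toℕ i + n × c mod n ≡ j
window {n} i j with toℕ i ≤? toℕ j
... | yes i≤j = toℕ j , i≤j , ℕ.<-≤-trans (Fin.toℕ<n j) (ℕ.m≤n+m n (toℕ i)) ,
      Fin.toℕ-injective (trans (toℕ-mod _ n) (m<n⇒m%n≡m (Fin.toℕ<n j)))
... | no i≰j = toℕ j + n , ℕ.≤-trans (ℕ.<⇒≤ (Fin.toℕ<n i)) (ℕ.m≤n+m n (toℕ j)) ,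
      ℕ.+-monoˡ-< n (ℕ.≰⇒> i≰j) ,
      Fin.toℕ-injective (trans (toℕ-mod _ n) (trans ([m+n]%n≡m%n (toℕ j) n) (m<n⇒m%n≡m (Fin.toℕ<n j))))

module _ {G : Graph} where
  open Graph G
  open ClosedWalk renaming (step to walkStep; length to walkLength)

  HasEdge-sym : ∀ (W : ClosedWalk G) {u v} → HasEdge W u v → HasEdge W v u
  HasEdge-sym W (i , inj₁ h) = i , inj₂ h
  HasEdge-sym W (i , inj₂ h) = i , inj₁ h

  HasEdge⇒∈ : ∀ (W : ClosedWalk G) {u v} → HasEdge W u v → u ∈ᵛ W
  HasEdge⇒∈ W (i , inj₁ (p , _)) = i , p
  HasEdge⇒∈ W (i , inj₂ (_ , p)) = _ , p

  HasEdge⇒~ : ∀ (W : ClosedWalk G) {u v} → HasEdge W u v → u ~ v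
  HasEdge⇒~ W (i , inj₁ (refl , refl)) = walkStep W i
  HasEdge⇒~ W (i , inj₂ (refl , refl)) = ~-sym (walkStep W i)

  -- The boundary of a face at v, cut open at v: a path from w to the other
  -- neighbour of v along the face.
  record Rim (W : ClosedWalk G) (v w : V) : Set where
    field
      other : V
      inner : List V
      seg   : Seg _~_ w inner other
      uniq  : Unique (v ∷ w ∷ inner ++ other ∷ [])
      cover : ∀ {u} → u ∈ᵛ W → u ≢ v → u ∈ w ∷ inner ++ other ∷ []
      inside : ∀ {u} → u ∈ w ∷ inner ++ other ∷ [] → u ∈ᵛ W
      edge₁ : HasEdge W v w
      edge₂ : HasEdge W v other
      edges : ∀ {u} → HasEdge W v u → u ≡ w ⊎ u ≡ other

  flip : ∀ {W v w} (r : Rim W v w) → Rim W v (Rim.other r)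
  flip {W} {v} {w} r = record
    { other = w ; inner = reverse inner ; seg = reverseˢ ~-sym seg
    ; uniq = Unique-resp-↭ (prep v π) uniq
    ; cover = λ u∈ u≢ → ∈-resp-↭ π (cover u∈ u≢)
    ; inside = λ u∈ → inside (∈-resp-↭ (↭-sym π) u∈)
    ; edge₁ = edge₂ ; edge₂ = edge₁
    ; edges = λ h → Sum.swap (edges h) }
    where
    open Rim r
    π : w ∷ inner ++ other ∷ [] ↭ other ∷ reverse inner ++ w ∷ []
    π = subst (w ∷ inner ++ other ∷ [] ↭_)
          (trans (List.unfold-reverse w (inner ++ other ∷ [])) (cong (_++ w ∷ []) (List.reverse-++ inner (other ∷ []))))
          (↭-sym (↭-reverse _))

  module Unroll (W : ClosedWalk G) (W-cycle : IsCycle W) where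
    private n = walkLength W

    at : ℕ → V
    at k = vertex W (k mod n)

    at-step : ∀ k → at k ~ at (suc k)
    at-step k = subst (λ i → at k ~ vertex W i) (next-mod k) (walkStep W (k mod n))

    at-injective : ∀ {a b} → at a ≡ at b → a ≤ b → b < a + n → a ≡ b
    at-injective {a} {b} eq = mod-unique
      (trans (sym (toℕ-mod a n)) (trans (cong toℕ (proj₂ W-cycle eq)) (toℕ-mod b n)))

    ats : ℕ → ℕ → List V
    ats a zero    = []
    ats a (suc m) = at a ∷ ats (suc a) m

    ats⁻ : ∀ {a v} m → v ∈ ats a m → ∃ λ c → a ≤ c × c < m + a × v ≡ at c
    ats⁻ {a} (suc m) (here eq) = a , ℕ.≤-refl , s≤s (ℕ.m≤n+m a m) , eq
    ats⁻ {a} (suc m) (there h) =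
      let c , a<c , c< , eq = ats⁻ m h in c , ℕ.<⇒≤ a<c , subst (c <_) (ℕ.+-suc m a) c< , eq

    ats⁺ : ∀ {a c} m → a ≤ c → c < m + a → at c ∈ ats a m
    ats⁺ zero a≤c c< = ⊥-elim (ℕ.<⇒≱ c< a≤c)
    ats⁺ {a} {c} (suc m) a≤c c< with ℕ.m≤n⇒m<n∨m≡n a≤c
    ... | inj₂ refl = here refl
    ... | inj₁ a<c  = there (ats⁺ m a<c (subst (c <_) (sym (ℕ.+-suc m a)) c<))

    ats-unique : ∀ a m → m ≤ n → Unique (ats a m)
    ats-unique a zero    _   = []
    ats-unique a (suc m) m<n = Unique-∷⁺ a∉ (ats-unique (suc a) m (ℕ.<⇒≤ m<n))
      where
      a∉ : at a ∉ ats (suc a) m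
      a∉ h with ats⁻ m h
      ... | c , a<c , c< , eq = ℕ.<⇒≢ a<c (at-injective eq (ℕ.<⇒≤ a<c)
              (ℕ.<-≤-trans c< (ℕ.≤-trans (ℕ.≤-reflexive (trans (ℕ.+-suc m a) (ℕ.+-comm (suc m) a))) (ℕ.+-monoʳ-≤ a m<n))))

    run : ∀ a m → Seg _~_ (at a) (ats (suc a) m) (at (m + suc a))
    run a zero    = edge (at-step a)
    run a (suc m) = step (at-step a) (subst (λ k → Seg _~_ (at (suc a)) (ats (suc (suc a)) m) (at k))
                                        (ℕ.+-suc m (suc a)) (run (suc a) m))

    ats-snoc : ∀ a m → ats a (suc m) ≡ ats a m ++ at (m + a) ∷ []
    ats-snoc a zero    = refl
    ats-snoc a (suc m) = cong (at a ∷_) (trans (ats-snoc (suc a) m)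
                           (cong (λ k → ats (suc a) m ++ at k ∷ []) (ℕ.+-suc m a)))

    at-index : ∀ i → at (toℕ i) ≡ vertex W i
    at-index i = cong (vertex W) (Fin.toℕ-injective (trans (toℕ-mod _ n) (m<n⇒m%n≡m (Fin.toℕ<n i))))

    at-next : ∀ {k i} → k mod n ≡ i → at (suc k) ≡ vertex W (next i)
    at-next {k} refl = cong (vertex W) (sym (next-mod k))

    at-period : ∀ k → at (n + k) ≡ at k
    at-period k = cong (vertex W) (mod-cong {n + k} {k}
      (trans (cong (_% n) (ℕ.+-comm n k)) ([m+n]%n≡m%n k n)))

    rim : ∀ i → Rim W (vertex W i) (vertex W (next i))
    rim i with ℕ.m≤n⇒∃[o]m+o≡n (proj₁ W-cycle)
    -- Besides `v`, its successor and `other` there are `m` vertices. With `v` at position `a`, its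
    -- successor is at `1 + a`, the inner vertices start at `2 + a`, and `other` is at
    -- `m + (2 + a)`, just before `v` returns at `n + a`.
    ... | m , 3+m≡n = record
      { other = z
      ; inner = ats (2 + a) m
      ; seg = subst (λ v → Seg _~_ v (ats (2 + a) m) z) w≡ (run (suc a) m)
      ; uniq = subst Unique list≡ (ats-unique a n ℕ.≤-refl)
      ; cover = cover
      ; inside = inside
      ; edge₁ = i , inj₁ (refl , refl)
      ; edge₂ = (m + (2 + a)) mod n ,
          inj₂ (refl , trans (sym (at-next {m + (2 + a)} refl)) (trans (cong at last≡) (trans (at-period a) v≡)))
      ; edges = edges }
      where
      a = toℕ i
      z = at (m + (2 + a))
      v≡ = at-index i
      w≡ : at (suc a) ≡ vertex W (next i)
      w≡ = at-next (Fin.toℕ-injective (trans (toℕ-mod a n) (m<n⇒m%n≡m (Fin.toℕ<n i))))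
      last≡ : suc (m + (2 + a)) ≡ n + a
      last≡ = trans (cong suc (trans (ℕ.+-suc m (suc a)) (cong suc (ℕ.+-suc m a)))) (cong (_+ a) 3+m≡n)
      rim≡ : ats (suc a) (2 + m) ≡ vertex W (next i) ∷ ats (2 + a) m ++ z ∷ []
      rim≡ = Eq.cong₂ _∷_ w≡ (ats-snoc (2 + a) m)
      list≡ : ats a n ≡ vertex W i ∷ vertex W (next i) ∷ ats (2 + a) m ++ z ∷ []
      list≡ = trans (cong (ats a) (sym 3+m≡n)) (Eq.cong₂ _∷_ v≡ rim≡)
      cover : ∀ {u} → u ∈ᵛ W → u ≢ vertex W i → u ∈ vertex W (next i) ∷ ats (2 + a) m ++ z ∷ []
      cover (j , refl) u≢v with window i j
      ... | c , a≤c , c< , refl with ℕ.m≤n⇒m<n∨m≡n a≤c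
      ...   | inj₂ refl = ⊥-elim (u≢v v≡)
      ...   | inj₁ a<c = subst (at c ∈_) rim≡ (ats⁺ (2 + m) a<c (subst (c <_)
                (trans (ℕ.+-comm a n) (trans (cong (_+ a) (sym 3+m≡n)) (sym (ℕ.+-suc (2 + m) a)))) c<))
      inside : ∀ {u} → u ∈ vertex W (next i) ∷ ats (2 + a) m ++ z ∷ [] → u ∈ᵛ W
      inside {u} h with ats⁻ {suc a} (2 + m) (subst (u ∈_) (sym rim≡) h)
      ... | c , _ , _ , eq = c mod n , sym eq
      edges : ∀ {u} → HasEdge W (vertex W i) u → u ≡ vertex W (next i) ⊎ u ≡ z
      edges (j , inj₁ (p , refl)) = inj₁ (cong (vertex W ∘ next) (proj₂ W-cycle p))
      edges (j , inj₂ (refl , p)) with window i j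
      ... | c , a≤c , c< , refl = inj₂ (cong at (ℕ.suc-injective (trans
              (at-injective {suc c} {n + a} (trans (at-next {c} refl) (trans p (sym (trans (at-period a) v≡))))
                 (subst (suc c ≤_) (ℕ.+-comm a n) c<) (s≤s (subst (n + a ≤_) (ℕ.+-comm n c) (ℕ.+-monoʳ-≤ n a≤c))))
              (sym last≡))))

    -- Traversals at `i` and `j` in opposite directions would give `next (next i) ≡ i`, impossible
    -- in length at least three. It follows that the two sides at an edge belong to different faces.
    traverses-once : ∀ {i j u v} → Traverses W i u v → Traverses W j u v → i ≡ j
    traverses-once {i} {j} = go
      where
      inj = proj₂ W-cycle
      next²≢ : next (next i) ≢ i
      next²≢ eq = ℕ.m≢1+n+m (toℕ i) {1} (at-injective {toℕ i} {2 + toℕ i}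
        (sym (trans (at-next {suc (toℕ i)} refl) (trans (cong (vertex W) eq) (sym (at-index i)))))
        (ℕ.m≤n+m (toℕ i) 2) (subst (2 + toℕ i <_) (ℕ.+-comm _ (toℕ i)) (ℕ.+-monoˡ-≤ (toℕ i) (proj₁ W-cycle))))
      go : ∀ {u v} → Traverses W i u v → Traverses W j u v → i ≡ j
      go (inj₁ (p , _)) (inj₁ (q , _)) = inj (trans p (sym q))
      go (inj₂ (p , _)) (inj₂ (q , _)) = inj (trans p (sym q))
      go (inj₁ (p , p′)) (inj₂ (q , q′)) = ⊥-elim (next²≢ (trans (cong next (inj (trans p′ (sym q)))) (inj (trans q′ (sym p)))))
      go (inj₂ (p , p′)) (inj₁ (q , q′)) = ⊥-elim (next²≢ (trans (cong next (inj (trans p′ (sym q)))) (inj (trans q′ (sym p)))))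

  rimFrom : ∀ (W : ClosedWalk G) → IsCycle W → ∀ {v w} → HasEdge W v w → Rim W v w
  rimFrom W W-cycle h with HasEdge⇒∈ W h
  ... | i , refl with Rim.edges (Unroll.rim W W-cycle i) h
  ...   | inj₁ refl = Unroll.rim W W-cycle i
  ...   | inj₂ refl = flip (Unroll.rim W W-cycle i)

-- The wheel around a vertex

module Faces {G : Graph} {E : CellularEmbedding G} (polyhedral : IsPolyhedral E) where
  open Graph G
  open ClosedWalk using (vertex; length-nonZero)
  open CellularEmbedding E
  open IsPolyhedral polyhedral

  Face = Fin faceCount

  Edge : Face → V → V → Set
  Edge f = HasEdge (face f)

  _∈ᶠ_ : V → Face → Set
  v ∈ᶠ f = v ∈ᵛ face f

  MeetProperly-edge : ∀ (W W′ : ClosedWalk G) {u v} → MeetProperly W W′ → u ∈ᵛ W → u ∈ᵛ W′ → v ∈ᵛ W → v ∈ᵛ W′ →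
                      u ≢ v → HasEdge W u v
  MeetProperly-edge W W′ {u} (inj₁ none) u∈ u∈′ _ _ _ = ⊥-elim (none u (u∈ , u∈′))
  MeetProperly-edge W W′ (inj₂ (inj₁ (w , only))) u∈ u∈′ v∈ v∈′ u≢v =
    ⊥-elim (u≢v (trans (Equivalence.to (only _) (u∈ , u∈′)) (sym (Equivalence.to (only _) (v∈ , v∈′)))))
  MeetProperly-edge W W′ (inj₂ (inj₂ (a , b , e , _ , only))) u∈ u∈′ v∈ v∈′ u≢v
    with Equivalence.to (only _) (u∈ , u∈′) | Equivalence.to (only _) (v∈ , v∈′)
  ... | inj₁ refl | inj₁ refl = ⊥-elim (u≢v refl)
  ... | inj₂ refl | inj₂ refl = ⊥-elim (u≢v refl)
  ... | inj₁ refl | inj₂ refl = e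
  ... | inj₂ refl | inj₁ refl = HasEdge-sym W e

  MeetProperly-two : ∀ (W W′ : ClosedWalk G) {u v w} → MeetProperly W W′ → u ∈ᵛ W → u ∈ᵛ W′ → v ∈ᵛ W → v ∈ᵛ W′ →
                     w ∈ᵛ W → w ∈ᵛ W′ → u ≢ v → u ≢ w → v ≡ w
  MeetProperly-two W W′ {u} (inj₁ none) u∈ u∈′ _ _ _ _ _ _ = ⊥-elim (none u (u∈ , u∈′))
  MeetProperly-two W W′ (inj₂ (inj₁ (_ , only))) u∈ u∈′ v∈ v∈′ _ _ u≢v _ =
    ⊥-elim (u≢v (trans (Equivalence.to (only _) (u∈ , u∈′)) (sym (Equivalence.to (only _) (v∈ , v∈′)))))
  MeetProperly-two W W′ (inj₂ (inj₂ (a , b , _ , _ , only))) u∈ u∈′ v∈ v∈′ w∈ w∈′ u≢v u≢w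
    with Equivalence.to (only _) (u∈ , u∈′) | Equivalence.to (only _) (v∈ , v∈′) | Equivalence.to (only _) (w∈ , w∈′)
  ... | inj₁ refl | inj₁ refl | _         = ⊥-elim (u≢v refl)
  ... | inj₁ refl | _         | inj₁ refl = ⊥-elim (u≢w refl)
  ... | inj₁ refl | inj₂ refl | inj₂ refl = refl
  ... | inj₂ refl | inj₂ refl | _         = ⊥-elim (u≢v refl)
  ... | inj₂ refl | _         | inj₂ refl = ⊥-elim (u≢w refl)
  ... | inj₂ refl | inj₁ refl | inj₁ refl = refl

  sharedEdge : ∀ {f g u v} → f ≢ g → u ∈ᶠ f → u ∈ᶠ g → v ∈ᶠ f → v ∈ᶠ g → u ≢ v → Edge f u v
  sharedEdge {f} {g} f≢g = MeetProperly-edge (face f) (face g) (meet-properly f≢g)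

  twoFaces : ∀ {u v} → u ~ v → ∃₂ λ f g → f ≢ g × Edge f u v × Edge g u v × (∀ {h} → Edge h u v → h ≡ f ⊎ h ≡ g)
  twoFaces u~v with two-sides u~v
  ... | (f , i) , (g , j) , s≢t , on-s , on-t , only = f , g , f≢g s≢t on-s on-t , (i , on-s) , (j , on-t) ,
      λ (k , on-r) → Sum.map (cong proj₁) (cong proj₁) (only (_ , k) on-r)
    where
    f≢g : ∀ {f g i j u v} → (f , i) ≢ (g , j) → LiesOn (f , i) u v → LiesOn (g , j) u v → f ≢ g
    f≢g {f} s≢t on-s on-t refl = s≢t (cong (f ,_) (Unroll.traverses-once (face f) (boundary-cycle f) on-s on-t))

  otherFace : ∀ {f u v} → Edge f u v → ∃ λ g → f ≢ g × Edge g u v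
  otherFace {f} e with twoFaces (HasEdge⇒~ (face f) e)
  ... | g , h , g≢h , eg , eh , only with only e
  ...   | inj₁ refl = h , g≢h , eh
  ...   | inj₂ refl = g , g≢h ∘ sym , eg

  noThirdFace : ∀ {f g h u v} → f ≢ g → Edge f u v → Edge g u v → Edge h u v → h ≡ f ⊎ h ≡ g
  noThirdFace {f} f≢g ef eg eh with twoFaces (HasEdge⇒~ (face f) ef)
  ... | _ , _ , _ , _ , _ , only with only ef | only eg | only eh
  ...   | inj₁ refl | inj₁ refl | _         = ⊥-elim (f≢g refl)
  ...   | inj₂ refl | inj₂ refl | _         = ⊥-elim (f≢g refl)
  ...   | inj₁ refl | inj₂ refl | r         = r
  ...   | inj₂ refl | inj₁ refl | r         = Sum.swap r

  leadsTo⇒Edge : ∀ c {w} → LeadsTo c w → Edge (proj₁ c) (apex c) w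
  leadsTo⇒Edge (f , i) (inj₁ eq)             = i , inj₁ (refl , eq)
  leadsTo⇒Edge (f , i) (inj₂ (j , eq , eq′)) = j , inj₂ (eq′ , cong (vertex (face f)) eq)

  _∖_ : Rel V 0ℓ → V → Rel V 0ℓ
  (R ∖ v) u w = R u w × u ≢ v × w ≢ v

  module Around (v : V) where

    avoidSeg : ∀ {a l b} → Seg _~_ a l b → (∀ {u} → u ∈ a ∷ l ++ b ∷ [] → u ≢ v) → Seg (_~_ ∖ v) a l b
    avoidSeg (edge e)   h = edge (e , h (here refl) , h (there (here refl)))
    avoidSeg (step e s) h = step (e , h (here refl) , h (there (here refl))) (avoidSeg s (h ∘ there))

    faceRim : ∀ {f w} → Edge f v w → Rim (face f) v w
    faceRim {f} = rimFrom (face f) (boundary-cycle f)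

    -- The union of the faces in F, which form a fan around v, has a boundary
    -- path from first to last in G - v; f is the face of F at last.
    record Sector (F : Subset faceCount) : Set where
      field
        first last : V
        inner      : List V
        path       : Seg (_~_ ∖ v) first inner last
      boundary : List V
      boundary = first ∷ inner ++ last ∷ []
      field
        unique   : Unique boundary
        f        : Face
        f∈F      : f ∈ˢ F
        at-v     : ∀ {g} → g ∈ˢ F → v ∈ᶠ g
        cover    : ∀ {g u} → g ∈ˢ F → u ∈ᶠ g → u ≢ v → u ∈ boundary
        inside   : ∀ {u} → u ∈ boundary → u ≢ v × ∃ λ g → g ∈ˢ F × u ∈ᶠ g
        complete : ∀ {u g} → u ∈ inner → Edge g v u → g ∈ˢ F
        last∈    : ∀ {g} → g ∈ˢ F → last ∈ᶠ g → g ≡ f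
        f-last   : Edge f v last
        first-edge : ∃ λ g → g ∈ˢ F × Edge g v first
        single   : inner ≡ [] → first ∈ᶠ f

    -- `hub` and `complete` serve the umbrella condition: they start and continue the spreading of
    -- `F` over all faces at `v`.
    record Closed (F : Subset faceCount) : Set where
      field
        wheel    : Cyc (_~_ ∖ v)
        hub      : ∃ λ f → f ∈ˢ F × v ∈ᶠ f
        cover    : ∀ {g u} → g ∈ˢ F → u ∈ᶠ g → u ≢ v → u ∈ verts wheel
        complete : ∀ {u g} → u ∈ verts wheel → Edge g v u → g ∈ˢ F

    Edge⇒≢ : ∀ {f w} → Edge f v w → w ≢ v
    Edge⇒≢ {f} e w≡v = ~-irrefl (sym w≡v) (HasEdge⇒~ (face f) e)

    rim-∌v : ∀ {f w} (r : Rim (face f) v w) → ∀ {u} → u ∈ w ∷ Rim.inner r ++ Rim.other r ∷ [] → u ≢ v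
    rim-∌v r u∈ refl = Unique-∷⁻ (Rim.uniq r) u∈

    -- Another face with the edge from `v` to `u` would share both vertices with `f`, which would
    -- then have this edge too. But along `f` only the two ends of the rim are joined to `v`.
    rim-inner : ∀ {f w} (r : Rim (face f) v w) {u g} → u ∈ Rim.inner r → Edge g v u → g ≡ f
    rim-inner {f} {w} r {u} {g} u∈ e with g Fin.≟ f
    ... | yes g≡f = g≡f
    ... | no g≢f with edges (sharedEdge (g≢f ∘ sym) (HasEdge⇒∈ (face f) edge₁) (HasEdge⇒∈ (face g) e)
                        (inside (there (∈-++⁺ˡ u∈))) (HasEdge⇒∈ (face g) (HasEdge-sym (face g) e)) (Edge⇒≢ {g} e ∘ sym))
      where open Rim r
    ...   | inj₁ refl = ⊥-elim (Unique-∷⁻ (proj₁ (proj₂ (Unique-++⁻ (v ∷ []) (Rim.uniq r)))) (∈-++⁺ˡ u∈))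
    ...   | inj₂ refl = ⊥-elim (proj₂ (proj₂ (Unique-++⁻ (v ∷ w ∷ Rim.inner r) (Rim.uniq r)))
                                (there (there u∈) , here refl))

    start : ∀ {f w} → Edge f v w → Sector ⁅ f ⁆
    start {f} {w} e = record
      { first = w ; last = R.other ; inner = R.inner ; path = avoidSeg R.seg (rim-∌v r)
      ; unique = proj₁ (proj₂ (Unique-++⁻ (v ∷ []) R.uniq))
      ; f = f ; f∈F = Sub.x∈⁅x⁆ f
      ; at-v = λ g∈ → subst (v ∈ᶠ_) (sym (Sub.x∈⁅y⁆⇒x≡y f g∈)) (HasEdge⇒∈ (face f) e)
      ; cover = λ g∈ u∈ → R.cover (subst (_ ∈ᶠ_) (Sub.x∈⁅y⁆⇒x≡y f g∈) u∈)
      ; inside = λ u∈ → rim-∌v r u∈ , f , Sub.x∈⁅x⁆ f , R.inside u∈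
      ; complete = λ u∈ e → subst (_∈ˢ ⁅ f ⁆) (sym (rim-inner r u∈ e)) (Sub.x∈⁅x⁆ f)
      ; last∈ = λ g∈ _ → Sub.x∈⁅y⁆⇒x≡y f g∈
      ; f-last = R.edge₂
      ; first-edge = f , Sub.x∈⁅x⁆ f , e
      ; single = λ _ → R.inside (here refl) }
      where
      r = faceRim e
      module R = Rim r

    module _ {F : Subset faceCount} (σ : Sector F) where
      open Sector σ

      private
        nextFace = otherFace f-last
        g = proj₁ nextFace
        f≢g : f ≢ g
        f≢g = proj₁ (proj₂ nextFace)
        eg : Edge g v last
        eg = proj₂ (proj₂ nextFace)
        r = faceRim eg
        module R = Rim r
        F⁺ = F ∪ ⁅ g ⁆
        old : ∀ {h} → h ∈ˢ F → h ∈ˢ F⁺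
        old = Sub.x∈p∪q⁺ ∘ inj₁
        g∈ : g ∈ˢ F⁺
        g∈ = Sub.x∈p∪q⁺ (inj₂ (Sub.x∈⁅x⁆ g))
        new : ∀ {h} → h ∈ˢ F⁺ → h ∈ˢ F ⊎ h ≡ g
        new h∈ = Sum.map₂ (Sub.x∈⁅y⁆⇒x≡y g) (Sub.x∈p∪q⁻ F ⁅ g ⁆ h∈)
        v∈g : v ∈ᶠ g
        v∈g = HasEdge⇒∈ (face g) eg
        g∉F : g ∉ˢ F
        g∉F h = f≢g (sym (last∈ h (HasEdge⇒∈ (face g) (HasEdge-sym (face g) eg))))

        fg : ∀ {h} → h ≡ f ⊎ h ≡ g → h ∈ˢ F⁺
        fg (inj₁ refl) = old f∈F
        fg (inj₂ refl) = g∈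

        uR = proj₁ (proj₂ (Unique-++⁻ (v ∷ []) R.uniq))

        -- A common vertex would lie, like `v`, both on `g` and on a face of `F`, and proper meeting
        -- would make it a neighbour of `v` along `g`. Such neighbours are the ends of the rim, not
        -- inner vertices.
        inner# : ∀ {u} → u ∈ R.inner → u ∉ boundary
        inner# {u} u∈ u∈′ with inside u∈′
        ... | u≢v , h , h∈F , u∈h with R.edges (sharedEdge (λ g≡h → g∉F (subst (_∈ˢ F) (sym g≡h) h∈F)) v∈g (at-v h∈F)
                                                 (R.inside (there (∈-++⁺ˡ u∈))) u∈h (u≢v ∘ sym))
        ...   | inj₁ refl = Unique-∷⁻ uR (∈-++⁺ˡ u∈)
        ...   | inj₂ refl = proj₂ (proj₂ (Unique-++⁻ (last ∷ R.inner) uR)) (there u∈ , here refl)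

        uInner : Unique R.inner
        uInner = proj₁ (Unique-++⁻ R.inner (proj₁ (proj₂ (Unique-++⁻ (last ∷ []) uR))))

        edgeOther∉ : R.other ∉ inner
        edgeOther∉ h = g∉F (complete h R.edge₂)

        path⁺ : Seg (_~_ ∖ v) first (inner ++ last ∷ R.inner) R.other
        path⁺ = path ++ˢ avoidSeg R.seg (rim-∌v r)

        glued : ∀ {xs} → Disjoint boundary (R.inner ++ xs) → Unique (R.inner ++ xs) →
                Unique (first ∷ (inner ++ last ∷ R.inner) ++ xs)
        glued {xs} d u = subst Unique
          (cong (first ∷_) (trans (List.++-assoc inner (last ∷ []) (R.inner ++ xs)) (sym (List.++-assoc inner (last ∷ R.inner) xs))))
          (Unique.++⁺ unique u d)

        split⁺ : ∀ {u} → u ∈ inner ++ last ∷ R.inner → u ∈ inner ⊎ (u ≡ last ⊎ u ∈ R.inner)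
        split⁺ h with ∈-++⁻ inner h
        ... | inj₁ h           = inj₁ h
        ... | inj₂ (here eq)   = inj₂ (inj₁ eq)
        ... | inj₂ (there h)   = inj₂ (inj₂ h)

        complete⁺ : ∀ {u h} → u ∈ inner ++ last ∷ R.inner → Edge h v u → h ∈ˢ F⁺
        complete⁺ {u} {h} u∈ e with split⁺ u∈
        ... | inj₁ u∈          = old (complete u∈ e)
        ... | inj₂ (inj₁ refl) = fg (noThirdFace f≢g f-last eg e)
        ... | inj₂ (inj₂ u∈)   = fg (inj₂ (rim-inner r u∈ e))

        widen : ∀ {u} → u ∈ boundary → u ∈ first ∷ inner ++ last ∷ R.inner
        widen (here eq) = here eq
        widen (there h) with ∈-++⁻ inner h
        ... | inj₁ h         = there (∈-++⁺ˡ h)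
        ... | inj₂ (here eq) = there (∈-++⁺ʳ inner (here eq))

      F⊂F⁺ : F⁺ ⊋ F
      F⊂F⁺ = (λ {x} → old {x}) , g , g∈ , g∉F

      close : R.other ≡ first → Closed F⁺
      close other≡ = record
        { wheel = cyc (mkCyc (subst (Seg (_~_ ∖ v) first (inner ++ last ∷ R.inner)) other≡ path⁺) unique⁺ long)
        ; hub = f , old f∈F , at-v f∈F
        ; cover = cover⁺
        ; complete = complete⁺′ }
        where
        unique⁺ : Unique (first ∷ inner ++ last ∷ R.inner)
        unique⁺ = subst Unique (cong (first ∷_) (List.++-identityʳ _))
          (glued {[]} (λ (p , q) → inner# (subst (_ ∈_) (List.++-identityʳ _) q) p)
            (subst Unique (sym (List.++-identityʳ _)) uInner))
        g-other : Edge g v first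
        g-other = subst (Edge g v) other≡ R.edge₂
        -- Otherwise f and g would share the three vertices v, first and last.
        inner≢[] : inner ≢ []
        inner≢[] eq = Unique-∷⁻ unique (∈-++⁺ʳ inner (here
          (MeetProperly-two (face f) (face g) (meet-properly f≢g) (at-v f∈F) v∈g
            (single eq) (R.inside (there (∈-++⁺ʳ R.inner (here (sym other≡)))))
            (HasEdge⇒∈ (face f) (HasEdge-sym (face f) f-last)) (R.inside (here refl))
            (Edge⇒≢ {g} g-other ∘ sym) (Edge⇒≢ {g} eg ∘ sym)) ))
        two : ∀ (xs : List V) {y ys} → xs ≢ [] → 2 ≤ length (xs ++ y ∷ ys)
        two []           ≢[] = ⊥-elim (≢[] refl)
        two (_ ∷ [])     _   = s≤s (s≤s z≤n)
        two (_ ∷ _ ∷ xs) _   = s≤s (s≤s z≤n)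
        long : 2 ≤ length (inner ++ last ∷ R.inner)
        long = two inner inner≢[]
        cover⁺ : ∀ {h u} → h ∈ˢ F⁺ → u ∈ᶠ h → u ≢ v → u ∈ first ∷ inner ++ last ∷ R.inner
        cover⁺ h∈ u∈ u≢v with new h∈
        ... | inj₁ h∈F = widen (cover h∈F u∈ u≢v)
        ... | inj₂ refl with R.cover u∈ u≢v
        ...   | here refl = there (∈-++⁺ʳ inner (here refl))
        ...   | there h with ∈-++⁻ R.inner h
        ...     | inj₁ h         = there (∈-++⁺ʳ inner (there h))
        ...     | inj₂ (here eq) = here (trans eq other≡)
        complete⁺′ : ∀ {u h} → u ∈ first ∷ inner ++ last ∷ R.inner → Edge h v u → h ∈ˢ F⁺
        complete⁺′ (there u∈) e = complete⁺ u∈ e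
        complete⁺′ (here refl) e = atFirst first-edge e
          where
          atFirst : (∃ λ f₀ → f₀ ∈ˢ F × Edge f₀ v first) → ∀ {h} → Edge h v first → h ∈ˢ F⁺
          atFirst (f₀ , f₀∈F , e₀) e with noThirdFace (λ f₀≡g → g∉F (subst (_∈ˢ F) f₀≡g f₀∈F)) e₀ g-other e
          ... | inj₁ refl = old f₀∈F
          ... | inj₂ refl = g∈

      extend : R.other ≢ first → Sector F⁺
      extend other≢ = record
        { first = first ; last = R.other ; inner = inner ++ last ∷ R.inner ; path = path⁺
        ; unique = glued disj (proj₁ (proj₂ (Unique-++⁻ (last ∷ []) uR)))
        ; f = g ; f∈F = g∈
        ; at-v = λ h∈ → at-v⁺ (new h∈)
        ; cover = λ h∈ → cover⁺ (new h∈)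
        ; inside = inside⁺
        ; complete = complete⁺
        ; last∈ = λ h∈ → last∈⁺ (new h∈)
        ; f-last = R.edge₂
        ; first-edge = let f₀ , f₀∈F , e₀ = first-edge in f₀ , old f₀∈F , e₀
        ; single = λ eq → ⊥-elim (nonempty inner eq) }
        where
        nonempty : ∀ (xs : List V) {y ys} → xs ++ y ∷ ys ≢ []
        nonempty [] ()
        nonempty (_ ∷ _) ()
        other∉ : R.other ∉ boundary
        other∉ (here eq) = other≢ eq
        other∉ (there h) with ∈-++⁻ inner h
        ... | inj₁ h         = edgeOther∉ h
        ... | inj₂ (here eq) = proj₂ (proj₂ (Unique-++⁻ (last ∷ []) uR)) (here eq , ∈-++⁺ʳ R.inner (here refl))
        disj : Disjoint boundary (R.inner ++ R.other ∷ [])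
        disj (p , q) with ∈-++⁻ R.inner q
        ... | inj₁ q           = inner# q p
        ... | inj₂ (here refl) = other∉ p
        at-v⁺ : ∀ {h} → h ∈ˢ F ⊎ h ≡ g → v ∈ᶠ h
        at-v⁺ (inj₁ h∈)   = at-v h∈
        at-v⁺ (inj₂ refl) = v∈g
        cover⁺ : ∀ {h u} → h ∈ˢ F ⊎ h ≡ g → u ∈ᶠ h → u ≢ v → u ∈ first ∷ (inner ++ last ∷ R.inner) ++ R.other ∷ []
        cover⁺ (inj₁ h∈F) u∈ u≢v = ∈-++⁺ˡ (widen (cover h∈F u∈ u≢v))
        cover⁺ (inj₂ refl) u∈ u≢v =
          there (subst (_ ∈_) (sym (List.++-assoc inner (last ∷ R.inner) _)) (∈-++⁺ʳ inner (R.cover u∈ u≢v)))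
        inside⁺ : ∀ {u} → u ∈ first ∷ (inner ++ last ∷ R.inner) ++ R.other ∷ [] → u ≢ v × ∃ λ h → h ∈ˢ F⁺ × u ∈ᶠ h
        inside⁺ (here eq) = let u≢v , h , h∈ , u∈ = inside (here eq) in u≢v , h , old h∈ , u∈
        inside⁺ (there u∈) with ∈-++⁻ inner (subst (_ ∈_) (List.++-assoc inner (last ∷ R.inner) _) u∈)
        ... | inj₁ u∈ = let u≢v , h , h∈ , u∈ = inside (there (∈-++⁺ˡ u∈)) in u≢v , h , old h∈ , u∈
        ... | inj₂ u∈ = rim-∌v r u∈ , g , g∈ , R.inside u∈
        last∈⁺ : ∀ {h} → h ∈ˢ F ⊎ h ≡ g → R.other ∈ᶠ h → h ≡ g
        last∈⁺ (inj₂ eq) _ = eq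
        last∈⁺ (inj₁ h∈F) u∈ = ⊥-elim (other∉ (cover h∈F u∈ (Edge⇒≢ {g} R.edge₂)))

    -- Each extension adds a face, and there are finitely many, so the sector closes up.
    grow : ∀ {F} → Acc _⊋_ F → Sector F → ∃ Closed
    grow (acc rs) σ with Rim.other (faceRim (proj₂ (proj₂ (otherFace (Sector.f-last σ))))) Fin.≟ Sector.first σ
    ... | yes eq = _ , close σ eq
    ... | no neq = grow (rs (F⊂F⁺ σ)) (extend σ neq)

    -- Linked corners at `v` share an edge from `v` to some `w`. If the first face is in `F`, then
    -- `w` is on the wheel and `complete` puts the second face into `F`. By `umbrella` this reaches
    -- all faces at `v`, and `cover` puts their vertices on the wheel.
    nbrs⊆wheel : ∀ {F} (c : Closed F) → ∀ {u} → v ~ u → u ∈ verts (Closed.wheel c)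
    nbrs⊆wheel {F} c v~u with twoFaces v~u
    ... | h , _ , _ , e , _ =
      cover (all∈F h (HasEdge⇒∈ (face h) e)) (HasEdge⇒∈ (face h) (HasEdge-sym (face h) e)) (Edge⇒≢ {h} e)
      where
      open Closed c
      spread : ∀ {c d} → Star Linked c d → apex c ≡ v → proj₁ c ∈ˢ F → proj₁ d ∈ˢ F
      spread ε _ f∈ = f∈
      spread (_◅_ {c} {d} (ac≡ad , w , lc , ld) links) refl f∈ =
        spread links (sym ac≡ad) (complete
          (cover f∈ (HasEdge⇒∈ (face (proj₁ c)) (HasEdge-sym (face (proj₁ c)) ec)) (Edge⇒≢ {proj₁ c} ec))
          (subst (λ a → Edge (proj₁ d) a w) (sym ac≡ad) (leadsTo⇒Edge d ld)))
        where ec = leadsTo⇒Edge c lc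
      all∈F : ∀ h → v ∈ᶠ h → h ∈ˢ F
      all∈F h (i , eq) = let f , f∈F , (j , eq′) = hub
                         in spread (umbrella (f , j) (h , i) (trans eq′ (sym eq))) eq′ f∈F

  wheelAt : ∀ {v w} → v ~ w → Σ[ K ∈ Cyc (_~_ ∖ v) ] (∀ {u} → v ~ u → u ∈ verts K)
  wheelAt {v} v~w with twoFaces v~w
  ... | f , _ , _ , e , _ = let _ , c = grow (⊃-wellFounded _) (start e) in Closed.wheel c , nbrs⊆wheel c
    where open Around v

-- Small cuts

module _ {V : Set} {R : Rel V 0ℓ} where

  Seg-steps : ∀ {a l b} → Seg R a l b → (j : Fin (length l)) → R (lookup (a ∷ l) (inject₁ j)) (lookup l j)
  Seg-steps (step e s) zero    = e
  Seg-steps (step e s) (suc j) = Seg-steps s j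

  Seg-last : ∀ {a l b} → Seg R a l b → R (lookup (a ∷ l) (fromℕ (length l))) b
  Seg-last (edge e)   = e
  Seg-last (step e s) = Seg-last s

next-inject₁ : ∀ {n} (j : Fin n) → next (inject₁ j) ≡ suc j
next-inject₁ {n} j = Fin.toℕ-injective (trans (toℕ-mod (suc (toℕ (inject₁ j))) (suc n))
  (trans (cong (λ k → suc k % suc n) (Fin.toℕ-inject₁ j)) (m<n⇒m%n≡m (s≤s (Fin.toℕ<n j)))))

next-fromℕ : ∀ n → next (fromℕ n) ≡ zero
next-fromℕ n = Fin.toℕ-injective (trans (toℕ-mod (suc (toℕ (fromℕ n))) (suc n))
  (trans (cong (λ k → suc k % suc n) (Fin.toℕ-fromℕ n)) (n%n≡0 (suc n))))

lookup-injective : ∀ {A : Set} {xs : List A} → Unique xs → Injective _≡_ _≡_ (lookup xs)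
lookup-injective (_ ∷ _)  {zero}  {zero}  _  = refl
lookup-injective (x∉ ∷ _) {zero}  {suc j} eq = ⊥-elim (All.lookup x∉ (∈-lookup j) eq)
lookup-injective (x∉ ∷ _) {suc i} {zero}  eq = ⊥-elim (All.lookup x∉ (∈-lookup i) (sym eq))
lookup-injective (_ ∷ u)  {suc i} {suc j} eq = cong suc (lookup-injective u eq)

module _ (G : Graph) where
  open Graph G

  module _ {R : Rel V 0ℓ} (R⊆~ : ∀ {u v} → R u v → u ~ v) where

    toClosedWalk : Cyc R → ClosedWalk G
    toClosedWalk (cyc {c} {l} K) = record { length = suc (length l) ; vertex = lookup (c ∷ l) ; step = steps }
      where
      steps : ∀ i → lookup (c ∷ l) i ~ lookup (c ∷ l) (next i)
      steps i with view i
      ... | ‵fromℕ = subst (λ k → lookup (c ∷ l) (fromℕ (length l)) ~ lookup (c ∷ l) k)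
                       (sym (next-fromℕ (length l))) (R⊆~ (Seg-last (IsCyc.closed K)))
      ... | ‵inject₁ j = subst (λ k → lookup (c ∷ l) (inject₁ j) ~ lookup (c ∷ l) k)
                           (sym (next-inject₁ j)) (R⊆~ (Seg-steps (IsCyc.closed K) j))

    toClosedWalk-isCycle : ∀ K → IsCycle (toClosedWalk K)
    toClosedWalk-isCycle (cyc K) = s≤s (IsCyc.long K) , lookup-injective (IsCyc.unique K)

    toClosedWalk-∈⁺ : ∀ K {v} → v ∈ verts K → v ∈ᵛ toClosedWalk K
    toClosedWalk-∈⁺ K v∈ = index v∈ , sym (Any.lookup-index v∈)

    toClosedWalk-∈⁻ : ∀ K {v} → v ∈ᵛ toClosedWalk K → v ∈ verts K
    toClosedWalk-∈⁻ K (i , refl) = ∈-lookup {xs = verts K} i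

module NoSmallCut {G : Graph} {E : CellularEmbedding G} (polyhedral : IsPolyhedral E) where
  open Graph G
  open CellularEmbedding E using (connected)
  open Faces polyhedral using (_∖_; wheelAt)
  open DecMembership (Fin._≟_ {order}) using (_∈?_)

  ∖-sym : ∀ {z} → B.Symmetric (_~_ ∖ z)
  ∖-sym (u~v , u≢z , v≢z) = ~-sym u~v , v≢z , u≢z

  ∖-avoids : ∀ {z} (K : Cyc (_~_ ∖ z)) {v} → v ∈ verts K → v ≢ z
  ∖-avoids K v∈ = proj₁ (proj₂ (proj₂ (nbr-of-cyc K v∈)))

  -- Otherwise the wheel at `s` would have a vertex in `D` and one beyond the cut, and by `straddle`
  -- it would pass through `s`, which it avoids.
  link-joined : ∀ {D s t u w} → Cut _~_ D s t → s ~ u → D u → s ~ w → D w ⊎ w ≡ t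
  link-joined {D} {s} {t} {u} {w} cut s~u Du s~w with D? w | w Fin.≟ t
    where open Cut cut
  ... | yes Dw | _       = inj₁ Dw
  ... | no _   | yes w≡t = inj₂ w≡t
  ... | no ¬Dw | no w≢t  = ⊥-elim (∖-avoids K (proj₁ (straddle cut∖ ∖-sym K (N⊆K s~u) Du (N⊆K s~w) ¬Tw)) refl)
    where
    K = proj₁ (wheelAt s~u)
    N⊆K : ∀ {v} → s ~ v → v ∈ verts K
    N⊆K = proj₂ (wheelAt s~u)
    cut∖ : Cut (_~_ ∖ s) D s t
    cut∖ = record { Cut cut ; closed = λ Du (e , _) → Cut.closed cut Du e }
    ¬Tw : Beyond D s t w
    ¬Tw (inj₁ Dw)         = ¬Dw Dw
    ¬Tw (inj₂ (inj₁ w≡s)) = ~-irrefl (sym w≡s) s~w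
    ¬Tw (inj₂ (inj₂ w≡t)) = w≢t w≡t

  closed-full : ∀ {D : Pred V 0ℓ} {x o} → (∀ {u v} → D u → u ~ v → D v) → D x → D o
  closed-full {D} {x} {o} closed = go (connected x o)
    where
    go : ∀ {x o} → Star _~_ x o → D x → D o
    go ε        Dx = Dx
    go (e ◅ es) Dx = go es (closed Dx e)

  nbrIn? : ∀ {D : Pred V 0ℓ} → Decidable D → ∀ s → Dec (∃ λ u → (s ~ u) × D u)
  nbrIn? D? s = Fin.any? (λ u → (s ~? u) ×-dec D? u)

  -- If `s` has a neighbour in `D`, then by `link-joined` the set `D` with `s` added is closed under
  -- adjacency; otherwise `D` itself is. Connectedness then puts `o` into it.
  noCut₁ : ∀ {D s x o} → Cut _~_ D s s → D x → ¬ D o → o ≢ s → ⊥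
  noCut₁ {D} {s} cut Dx ¬Do o≢s with nbrIn? (Cut.D? cut) s
  ... | no none = ¬Do (closed-full closed′ Dx)
    where
    closed′ : ∀ {u v} → D u → u ~ v → D v
    closed′ Du e with Cut.closed cut Du e
    ... | inj₁ Dv          = Dv
    ... | inj₂ (inj₁ refl) = ⊥-elim (none (_ , ~-sym e , Du))
    ... | inj₂ (inj₂ refl) = ⊥-elim (none (_ , ~-sym e , Du))
  ... | yes (w , s~w , Dw) = Sum.[ ¬Do , o≢s ] (closed-full {λ v → D v ⊎ v ≡ s} closed′ (inj₁ Dx))
    where
    closed′ : ∀ {u v} → D u ⊎ u ≡ s → u ~ v → D v ⊎ v ≡ s
    closed′ (inj₁ Du) e   = Sum.map₂ Sum.reduce (Cut.closed cut Du e)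
    closed′ (inj₂ refl) e = link-joined cut s~w Dw e

  -- Reduces to the single cut vertex `t`: if `s` has a neighbour in `D`, it is moved into `D`, and
  -- otherwise `D` has no edge to it.
  noCut₂ : ∀ {D s t x o} → Cut _~_ D s t → D x → ¬ D o → o ≢ s → o ≢ t → ⊥
  noCut₂ {D} {s} {t} cut Dx ¬Do o≢s o≢t with s Fin.≟ t | nbrIn? (Cut.D? cut) s
  ... | yes refl | _      = noCut₁ cut Dx ¬Do o≢s
  ... | no s≢t   | no none = noCut₁ record { D? = D? ; s∉D = t∉D ; t∉D = t∉D ; closed = closed′ } Dx ¬Do o≢t
    where
    open Cut cut
    closed′ : ∀ {u v} → D u → u ~ v → D v ⊎ (v ≡ t ⊎ v ≡ t)
    closed′ Du e with closed Du e
    ... | inj₁ Dv          = inj₁ Dv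
    ... | inj₂ (inj₁ refl) = ⊥-elim (none (_ , ~-sym e , Du))
    ... | inj₂ (inj₂ v≡t)  = inj₂ (inj₁ v≡t)
  ... | no s≢t   | yes (w , s~w , Dw) = noCut₁ {λ v → D v ⊎ v ≡ s} record
    { D? = λ v → D? v ⊎-dec (v Fin.≟ s) ; s∉D = t∉ ; t∉D = t∉ ; closed = closed′ } (inj₁ Dx) Sum.[ ¬Do , o≢s ] o≢t
    where
    open Cut cut
    t∉ : ¬ (D t ⊎ t ≡ s)
    t∉ = Sum.[ t∉D , s≢t ∘ sym ]
    closed′ : ∀ {u v} → D u ⊎ u ≡ s → u ~ v → (D v ⊎ v ≡ s) ⊎ (v ≡ t ⊎ v ≡ t)
    closed′ (inj₁ Du) e with closed Du e
    ... | inj₁ Dv         = inj₁ (inj₁ Dv)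
    ... | inj₂ (inj₁ v≡s) = inj₁ (inj₂ v≡s)
    ... | inj₂ (inj₂ v≡t) = inj₂ (inj₁ v≡t)
    closed′ (inj₂ refl) e = Sum.map inj₁ inj₁ (link-joined cut s~w Dw e)

  -- In `G`, a set `D` that misses the wheel would be cut off from `z`, as all neighbours of `z` are
  -- on the wheel. So `z` is the outside vertex that contradicts `noCut₂` or `noCut₁`.
  wheel-nonSep : ∀ {z x} (K : Cyc (_~_ ∖ z)) → (∀ {u} → z ~ u → u ∈ verts K) → x ≢ z →
                 NonSep (_~_ ∖ z) x (verts K)
  wheel-nonSep {z} {x} K N⊆K x≢z {D} {s} {t} cut Dx with Fin.any? (λ k → Cut.D? cut k ×-dec (k ∈? verts K))
  ... | yes r    = r
  ... | no D#K = ⊥-elim (contradiction (s Fin.≟ z) (t Fin.≟ z))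
    where
    open Cut cut
    -- With its edges deleted, `z` may be in `D` or be one of `s` and `t`. It is taken out of `D`,
    -- and if just one of `s` and `t` is `z`, the other takes its place; if both are, `D′` is closed
    -- under adjacency.
    D′ : Pred V 0ℓ
    D′ v = D v × v ≢ z
    D′? : Decidable D′
    D′? v = D? v ×-dec ¬? (v Fin.≟ z)
    closed′ : ∀ {u v} → D′ u → u ~ v → D′ v ⊎ (v ≢ z × (v ≡ s ⊎ v ≡ t))
    closed′ {u} {v} (Du , u≢z) e with v Fin.≟ z
    ... | yes refl = ⊥-elim (D#K (u , Du , N⊆K (~-sym e)))
    ... | no v≢z   = Sum.map (_, v≢z) (v≢z ,_) (closed Du (e , u≢z , v≢z))
    z∉D′ : ¬ D′ z
    z∉D′ (_ , z≢z) = z≢z refl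
    cut-off : ∀ {s′ t′} → ¬ D s′ → ¬ D t′ → (∀ {v} → v ≢ z → v ≡ s ⊎ v ≡ t → v ≡ s′ ⊎ v ≡ t′) → Cut _~_ D′ s′ t′
    cut-off s∉ t∉ f = record
      { D? = D′? ; s∉D = s∉ ∘ proj₁ ; t∉D = t∉ ∘ proj₁
      ; closed = λ D′u e → Sum.map₂ (λ (v≢z , st) → f v≢z st) (closed′ D′u e) }
    contradiction : Dec (s ≡ z) → Dec (t ≡ z) → ⊥
    contradiction (no s≢z) (no t≢z) = noCut₂ (cut-off s∉D t∉D (λ _ st → st)) (Dx , x≢z) z∉D′ (s≢z ∘ sym) (t≢z ∘ sym)
    contradiction (no s≢z) (yes refl) = noCut₁
      (cut-off s∉D s∉D λ { _ (inj₁ e) → inj₁ e ; v≢z (inj₂ e) → ⊥-elim (v≢z e) }) (Dx , x≢z) z∉D′ (s≢z ∘ sym)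
    contradiction (yes refl) (no t≢z) = noCut₁
      (cut-off t∉D t∉D λ { _ (inj₂ e) → inj₁ e ; v≢z (inj₁ e) → ⊥-elim (v≢z e) }) (Dx , x≢z) z∉D′ (t≢z ∘ sym)
    contradiction (yes refl) (yes refl) = z∉D′ (closed-full {D′} (λ D′u e → inD′ (closed′ D′u e)) (Dx , x≢z))
      where
      inD′ : ∀ {v} → D′ v ⊎ (v ≢ z × (v ≡ z ⊎ v ≡ z)) → D′ v
      inD′ (inj₁ D′v)        = D′v
      inD′ (inj₂ (v≢z , st)) = ⊥-elim (v≢z (Sum.reduce st))

theorem1p5 : (G : Graph) (E : CellularEmbedding G) → IsPolyhedral E →
    (x₁ x₂ x₃ z : Graph.V G) →
    x₁ ≢ x₂ → x₁ ≢ x₃ → x₂ ≢ x₃ →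
    z ≢ x₁ → z ≢ x₂ → z ≢ x₃ →
    ∃ λ (C : ClosedWalk G) →
    IsCycle C × x₁ ∈ᵛ C × x₂ ∈ᵛ C × x₃ ∈ᵛ C × z ∉ᵛ C
theorem1p5 G E polyhedral x₁ x₂ x₃ z x₁≢x₂ x₁≢x₃ x₂≢x₃ z≢x₁ z≢x₂ z≢x₃ =
  toClosedWalk G proj₁ C , toClosedWalk-isCycle G proj₁ C ,
  toClosedWalk-∈⁺ G proj₁ C x₁∈ , toClosedWalk-∈⁺ G proj₁ C x₂∈ , toClosedWalk-∈⁺ G proj₁ C x₃∈ ,
  λ z∈ → ∖-avoids C (toClosedWalk-∈⁻ G proj₁ C z∈) refl
  where
  open Graph G
  open NoSmallCut polyhedral
  open Faces polyhedral using (_∖_; wheelAt)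

  -- The wheel at `z` is built from an edge at `z`; connectedness supplies one, as `x₁` differs from
  -- `z`.
  firstStep : ∀ {u v} → Star _~_ u v → u ≢ v → ∃ λ w → u ~ w
  firstStep ε       u≢u = ⊥-elim (u≢u refl)
  firstStep (e ◅ _) _   = _ , e

  wheel : Σ[ K ∈ Cyc (_~_ ∖ z) ] (∀ {u} → z ~ u → u ∈ verts K)
  wheel = wheelAt (proj₂ (firstStep (CellularEmbedding.connected E z x₁) z≢x₁))
  K = proj₁ wheel

  ∖? : B.Decidable (_~_ ∖ z)
  ∖? u v = (u ~? v) ×-dec ¬? (u Fin.≟ z) ×-dec ¬? (v Fin.≟ z)

  through : Through ∖-sym ∖? (λ eq e → ~-irrefl eq (proj₁ e)) x₁ x₂ x₃
  through = throughThree ∖-sym ∖? (λ eq e → ~-irrefl eq (proj₁ e)) K x₁≢x₂ x₁≢x₃ x₂≢x₃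
              (wheel-nonSep K (proj₂ wheel) (z≢x₁ ∘ sym))
              (wheel-nonSep K (proj₂ wheel) (z≢x₂ ∘ sym))
              (wheel-nonSep K (proj₂ wheel) (z≢x₃ ∘ sym))
  C   = proj₁ through
  x₁∈ = proj₁ (proj₂ through)
  x₂∈ = proj₁ (proj₂ (proj₂ through))
  x₃∈ = proj₂ (proj₂ (proj₂ through))
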